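{- For any Eulerian poset $P=[\widehat{0},\widehat{1}]$ of rank $n+1$ ($n\ge 0$) we have $$ \operatorname{t}([\widehat{0},\widehat{1}),x)=\Phi_{P}^{\operatorname{rev}}(\mathcal{C},\mathcal{D})(1), $$ where $\mathcal{C},\mathcal{D}:\mathbb{Q}[x]\to\mathbb{Q}[x]$ are the linear operators given by $$ \mathcal{C}(x^m)=\begin{cases} x^{m+1}-x^{m-1} & \text{if } m\geq 2,\\ x^{m+1} & \text{if } m\in\{0,1\},\end{cases} \qquad \mathcal{D}(x^m)=\begin{cases} -1 & \text{if } m=2,\\ 1 & \text{if } m=0,\\ 0 & \text{otherwise,}\end{cases} $$ and $\Phi_{P}^{\operatorname{rev}}(\mathcal{C},\mathcal{D})$ is the linear operator obtained from the $cd$-index $\Phi_P(c,d)$ by first taking the reverse of each $cd$-monomial and then replacing each $c$ with $\mathcal{C}$ and each $d$ with $\mathcal{D}$ (products of letters becoming compositions of operators, the rightmost factor acting first).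
   Context: A graded poset is a finite poset with a unique minimum $\widehat{0}$, a unique maximum $\widehat{1}$ and a rank function $\rho:P\to\mathbb{N}$ with $\rho(\widehat{0})=0$ and $\rho(y)=\rho(x)+1$ whenever $y$ covers $x$; its rank is $\rho(\widehat{1})$. It is Eulerian if $\sum_{z\in[u,v]}(-1)^{\rho(z)}=0$ for all $u<v$. Write $[\widehat{0},p)=\{q: q<p\}$ and $[1,n]=\{1,\dots,n\}$. $cd$-index: for a graded poset $P$ of rank $n+1$ and $S\subseteq[1,n]$, let $f_S$ be the number of maximal chains of $P_S=\{u\in P:\rho(u)\in S\}$, and $h_S=\sum_{T\subseteq S}(-1)^{|S|-|T|}f_T$. The $ab$-index is $\sum_{S\subseteq[1,n]}h_Su_S$, where $u_S=u_1\cdots u_n$ is the word in noncommuting letters with $u_i=b$ if $i\in S$ and $u_i=a$ if $i\notin S$. If $P$ is Eulerian, the $ab$-index is (uniquely) a polynomial $\Phi_P(c,d)$ in the noncommuting variables $c=a+b$ and $d=ab+ba$, called the $cd$-index. Stanley's toric polynomials: $f(\emptyset,x)=g(\emptyset,x)=1$ ($\emptyset$ being $[\widehat{0},\widehat{1})$ for the Eulerian poset of rank $0$), and for an Eulerian poset of rank at least $1$, $$f([\widehat{0},\widehat{1}),x)=\sum_{p\in[\widehat{0},\widehat{1})} g([\widehat{0},p),x)(x-1)^{\rho(\widehat{1})-1-\rho(p)},$$ $$g([\widehat{0},\widehat{1}),x)=\sum_{i=0}^{\lfloor(\rho(\widehat{1})-1)/2\rfloor}\left([x^i]f([\widehat{0},\widehat{1}),x)-[x^{i-1}]f([\widehat{0},\widehat{1}),x)\right)x^i.$$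 By a theorem of Stanley, if the rank is $n+1$ then $f([\widehat{0},\widehat{1}),x)$ has degree $n$ and satisfies $x^nf([\widehat{0},\widehat{1}),1/x)=f([\widehat{0},\widehat{1}),x)$. Short toric polynomial: for an Eulerian poset of rank $n+1$, $\operatorname{t}([\widehat{0},\widehat{1}),x)$ is the unique polynomial $q(x)$ of degree $n$ with $q(x)=(-1)^nq(-x)$ and $f([\widehat{0},\widehat{1}),x)=x^{n/2}\left(q(\sqrt{x})+q(1/\sqrt{x})-q(0)\right)$; equivalently, it is obtained from $x^{n}f([\widehat{0},\widehat{1}),x^{ -2})$ by discarding all terms of negative degree. -}

module Defs where

open import Data.Nat.Base as ℕ using (ℕ; zero; suc; _∸_; ⌊_/2⌋)
open import Data.Integer.Base as ℤ using (ℤ; 0ℤ; -1ℤ)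
open import Data.Rational.Base as ℚ using (ℚ; 0ℚ; 1ℚ)
open import Data.Bool.Base using (if_then_else_)
open import Data.Fin.Base using (Fin; toℕ)
import Data.Fin.Properties as Fin
import Data.Nat.Properties as ℕ
open import Data.Fin.Induction using (po-wellFounded)
open import Data.Fin.Subset using (Subset; inside; outside; _∈_; _⊆_; _⊂_; ∣_∣)
open import Data.Fin.Subset.Properties using (_∈?_; _⊆?_; _⊂?_; anySubset?)
open import Data.List.Base as List
  using (List; []; _∷_; [_]; _++_; map; foldr; filter; length; reverse;
         replicate; applyUpTo; upTo; allFin; cartesianProductWith)
open import Data.List.Properties using (≡-dec; map-cong; filter-accept; filter-reject)
open import Data.Product.Base using (_×_; _,_; ∃-syntax)
open import Data.Sum.Base using (_⊎_)
open import Data.Vec.Base as Vec using (Vec)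
open import Function.Base using (_∘_; id)
open import Induction.WellFounded using (WellFounded; WfRec; module All; module FixPoint)
open import Level using (0ℓ)
open import Relation.Binary.Core using (Rel)
open import Relation.Binary.Definitions
  using (Decidable; DecidableEquality; Minimum; Maximum)
open import Relation.Binary.Structures using (IsDecPartialOrder)
import Relation.Binary.Construct.NonStrictToStrict as ToStrict
open import Relation.Binary.PropositionalEquality
  using (_≡_; refl; sym; trans; cong; cong₂)
import Relation.Unary as U
open import Relation.Nullary
  using (Dec; yes; no; does; ¬_; ¬?; _×-dec_; _⊎-dec_; _→-dec_)

-- Elements of ℚ[x]: the list of coefficients in increasing degree.  Trailing zeros are
-- allowed, so polynomials are compared with _≈ₚ_.

Poly : Set
Poly = List ℚ

coeff : Poly → ℕ → ℚ
coeff []      _       = 0ℚ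
coeff (a ∷ p) zero    = a
coeff (a ∷ p) (suc i) = coeff p i

infix 4 _≈ₚ_
_≈ₚ_ : Poly → Poly → Set
p ≈ₚ q = ∀ i → coeff p i ≡ coeff q i

0ₚ 1ₚ x-1 : Poly
0ₚ  = []
1ₚ  = [ 1ℚ ]
x-1 = (ℚ.- 1ℚ) ∷ 1ℚ ∷ []

x^_ : ℕ → Poly
x^ m = replicate m 0ℚ ++ [ 1ℚ ]

infixl 6 _+ₚ_ _-ₚ_
infixl 7 _*ₚ_ _·ₚ_
infixr 8 _^ₚ_

_+ₚ_ : Poly → Poly → Poly
[]      +ₚ q       = q
(a ∷ p) +ₚ []      = a ∷ p
(a ∷ p) +ₚ (b ∷ q) = (a ℚ.+ b) ∷ (p +ₚ q)

_·ₚ_ : ℚ → Poly → Poly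
a ·ₚ p = map (a ℚ.*_) p

-ₚ_ : Poly → Poly
-ₚ p = map ℚ.-_ p

_-ₚ_ : Poly → Poly → Poly
p -ₚ q = p +ₚ (-ₚ q)

_*ₚ_ : Poly → Poly → Poly
[]      *ₚ q = []
(a ∷ p) *ₚ q = (a ·ₚ q) +ₚ (0ℚ ∷ (p *ₚ q))

_^ₚ_ : Poly → ℕ → Poly
p ^ₚ zero  = 1ₚ
p ^ₚ suc k = p *ₚ (p ^ₚ k)

sumₚ : List Poly → Poly
sumₚ = foldr _+ₚ_ 0ₚ

Operator : Set
Operator = Poly → Poly

-- The linear operator with the given values on the monomials x^m.

linearExtension : (ℕ → Poly) → Operator
linearExtension φ []      = 0ₚ
linearExtension φ (a ∷ p) = (a ·ₚ φ 0) +ₚ linearExtension (φ ∘ suc) p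

-- Noncommutative polynomials as formal sums of scalar multiples of words.
-- A word may occur more than once, so these are compared with EqNC.

NCPoly : Set → Set
NCPoly X = List (ℚ × List X)

sumℚ : List ℚ → ℚ
sumℚ = foldr ℚ._+_ 0ℚ

module _ {X : Set} (_≟_ : DecidableEquality X) where

  wordCoeff : NCPoly X → List X → ℚ
  wordCoeff Φ w =
    sumℚ (map (λ (a , w′) → if does (≡-dec _≟_ w′ w) then a else 0ℚ) Φ)

  EqNC : NCPoly X → NCPoly X → Set
  EqNC Φ Ψ = ∀ w → wordCoeff Φ w ≡ wordCoeff Ψ w

module _ {X : Set} where

  letter : X → NCPoly X
  letter x = [ (1ℚ , [ x ]) ]

  1ₙ : NCPoly X
  1ₙ = [ (1ℚ , []) ]

  infixl 6 _+ₙ_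
  infixl 7 _*ₙ_ _·ₙ_

  _+ₙ_ : NCPoly X → NCPoly X → NCPoly X
  _+ₙ_ = _++_

  _·ₙ_ : ℚ → NCPoly X → NCPoly X
  a ·ₙ Φ = map (λ (b , w) → (a ℚ.* b , w)) Φ

  _*ₙ_ : NCPoly X → NCPoly X → NCPoly X
  _*ₙ_ = cartesianProductWith (λ (a , v) (b , w) → (a ℚ.* b , v ++ w))

  reverseWords : NCPoly X → NCPoly X
  reverseWords = map (λ (a , w) → (a , reverse w))

substitute : {X Y : Set} → (X → NCPoly Y) → NCPoly X → NCPoly Y
substitute σ = foldr (λ (a , w) Ψ → (a ·ₙ foldr _*ₙ_ 1ₙ (map σ w)) +ₙ Ψ) []

-- A word x₁⋯x_k becomes σ x₁ ∘ ⋯ ∘ σ x_k.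

substituteOperators : {X : Set} → (X → Operator) → NCPoly X → Operator
substituteOperators σ Φ p =
  sumₚ (map (λ (a , w) → a ·ₚ foldr (λ x → σ x ∘_) id w p) Φ)

data AB : Set where
  a b : AB

data CD : Set where
  c d : CD

_≟ᴬᴮ_ : DecidableEquality AB
a ≟ᴬᴮ a = yes refl
a ≟ᴬᴮ b = no λ ()
b ≟ᴬᴮ a = no λ ()
b ≟ᴬᴮ b = yes refl

infix 4 _≈ᴬᴮ_
_≈ᴬᴮ_ : NCPoly AB → NCPoly AB → Set
_≈ᴬᴮ_ = EqNC _≟ᴬᴮ_

cd→ab : CD → NCPoly AB
cd→ab c = letter a +ₙ letter b
cd→ab d = letter a *ₙ letter b +ₙ letter b *ₙ letter a

record GradedPoset : Set₁ where
  infix 4 _≤_ _<_ _<?_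
  field
    size              : ℕ
    _≤_               : Rel (Fin size) 0ℓ
    isDecPartialOrder : IsDecPartialOrder _≡_ _≤_
    0̂ 1̂               : Fin size
    minimum           : Minimum _≤_ 0̂
    maximum           : Maximum _≤_ 1̂

  open IsDecPartialOrder isDecPartialOrder public
    using (isPartialOrder; _≤?_)

  Carrier : Set
  Carrier = Fin size

  _<_ : Rel Carrier 0ℓ
  _<_ = ToStrict._<_ _≡_ _≤_

  _Covers_ : Rel Carrier 0ℓ
  y Covers x = x < y × ¬ (∃[ z ] x < z × z < y)

  field
    ρ        : Carrier → ℕ
    ρ-0̂      : ρ 0̂ ≡ 0
    ρ-covers : ∀ {x y} → y Covers x → ρ y ≡ suc (ρ x)

  _<?_ : Decidable _<_
  _<?_ = ToStrict.<-decidable _≡_ _≤_ Fin._≟_ _≤?_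

  <-wellFounded : WellFounded _<_
  <-wellFounded = po-wellFounded isPartialOrder

  rank : ℕ
  rank = ρ 1̂

sumℤ : List ℤ → ℤ
sumℤ = foldr ℤ._+_ 0ℤ

subsets : ∀ n → List (Subset n)
subsets zero    = [ Vec.[] ]
subsets (suc n) =
  map (outside Vec.∷_) (subsets n) ++ map (inside Vec.∷_) (subsets n)

-- g([0̂,1̂),x) from f = f([0̂,1̂),x) for a poset of rank r.  The case of
-- rank 0 is the convention g(∅,x) = 1.

toricDifference : Poly → ℕ → ℚ
toricDifference f zero    = coeff f zero
toricDifference f (suc i) = coeff f (suc i) ℚ.- coeff f i

f→g : ℕ → Poly → Poly
f→g zero    f = 1ₚ
f→g (suc r) f = applyUpTo (toricDifference f) (suc ⌊ r /2⌋)

module _ (P : GradedPoset) where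
  open GradedPoset P

  IsEulerian : Set
  IsEulerian = ∀ {u v} → u < v →
    sumℤ (map (λ z → -1ℤ ℤ.^ ρ z)
              (filter (λ z → (u ≤? z) ×-dec (z ≤? v)) (allFin size))) ≡ 0ℤ

  -- A set S ⊆ [1,n] is encoded as a Subset n, with i : Fin n standing
  -- for the rank suc (toℕ i).

  module _ {n : ℕ} (S : Subset n) where

    RankSelected : Carrier → Set
    RankSelected u = ∃[ i ] i ∈ S × ρ u ≡ suc (toℕ i)

    IsChain : Subset size → Set
    IsChain C = (∀ u → u ∈ C → RankSelected u) ×
                (∀ u v → u ∈ C → v ∈ C → u ≤ v ⊎ v ≤ u)

    IsMaximalChain : Subset size → Set
    IsMaximalChain C = IsChain C × ¬ (∃[ D ] IsChain D × C ⊂ D)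

    rankSelected? : U.Decidable RankSelected
    rankSelected? u = Fin.any? λ i → (i ∈? S) ×-dec (ρ u ℕ.≟ suc (toℕ i))

    isChain? : U.Decidable IsChain
    isChain? C =
      Fin.all? (λ u → (u ∈? C) →-dec rankSelected? u)
      ×-dec
      Fin.all? (λ u → Fin.all? λ v →
        (u ∈? C) →-dec ((v ∈? C) →-dec ((u ≤? v) ⊎-dec (v ≤? u))))

    isMaximalChain? : U.Decidable IsMaximalChain
    isMaximalChain? C =
      isChain? C ×-dec ¬? (anySubset? λ D → isChain? D ×-dec (C ⊂? D))

    flagF : ℕ
    flagF = length (filter isMaximalChain? (subsets size))

  flagH : ∀ {n} → Subset n → ℤ
  flagH {n} S =
    sumℤ (map (λ T → (-1ℤ ℤ.^ (∣ S ∣ ∸ ∣ T ∣)) ℤ.* (ℤ.+ flagF T))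
              (filter (_⊆? S) (subsets n)))

  abWord : ∀ {n} → Subset n → List AB
  abWord S = map (λ s → if s then b else a) (Vec.toList S)

  -- Meaningful when P has rank n + 1.

  abIndex : ℕ → NCPoly AB
  abIndex n = map (λ S → (flagH S ℚ./ 1 , abWord S)) (subsets n)

  IsCDIndex : ℕ → NCPoly CD → Set
  IsCDIndex n Φ = substitute cd→ab Φ ≈ᴬᴮ abIndex n

  -- The lower interval [0̂,p] of [0̂,v] has rank function the restriction
  -- of ρ, so that f([0̂,v),x) is defined by recursion on v inside P.

  toricTerm : ∀ {v} → ℕ → WfRec _<_ (λ _ → Poly) v →
              ∀ p → Dec (p < v) → Poly
  toricTerm r f p (yes p<v) = f→g (ρ p) (f p<v) *ₚ x-1 ^ₚ (r ∸ ρ p)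
  toricTerm r f p (no  _)   = 0ₚ

  toricSum : ∀ v → ℕ → WfRec _<_ (λ _ → Poly) v → Poly
  toricSum v zero    f = 1ₚ
  toricSum v (suc r) f =
    sumₚ (map (λ p → toricTerm r f p (p <? v)) (allFin size))

  toricStep : ∀ v → WfRec _<_ (λ _ → Poly) v → Poly
  toricStep v = toricSum v (ρ v)

  toricF : Carrier → Poly
  toricF = All.wfRec <-wellFounded 0ℓ (λ _ → Poly) toricStep

  toricG : Carrier → Poly
  toricG v = f→g (ρ v) (toricF v)

  -- The lemmas toricF-zero and toricF-suc below are the defining equations
  -- of f([0̂,v),x), with the recursion unfolded.

  toricStep-ext : ∀ v {f f′ : WfRec _<_ (λ _ → Poly) v} →
                  (∀ {p} p<v → f {p} p<v ≡ f′ p<v) →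
                  toricStep v f ≡ toricStep v f′
  toricStep-ext v {f} {f′} f≡f′ = go (ρ v)
    where
    term : ∀ r p (p<?v : Dec (p < v)) → toricTerm r f p p<?v ≡ toricTerm r f′ p p<?v
    term r p (yes p<v) = cong (λ q → f→g (ρ p) q *ₚ x-1 ^ₚ (r ∸ ρ p)) (f≡f′ p<v)
    term r p (no  _)   = refl

    go : ∀ r → toricSum v r f ≡ toricSum v r f′
    go zero    = refl
    go (suc r) = cong sumₚ (map-cong (λ p → term r p (p <? v)) (allFin size))

  toricF-unfold : ∀ v → toricF v ≡ toricStep v (λ {p} _ → toricF p)
  toricF-unfold v =
    FixPoint.unfold-wfRec <-wellFounded (λ _ → Poly) toricStep toricStep-ext {v}

  toricF-zero : ∀ v → ρ v ≡ 0 → toricF v ≡ 1ₚ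
  toricF-zero v ρv≡0 =
    trans (toricF-unfold v) (cong (λ r → toricSum v r (λ {p} _ → toricF p)) ρv≡0)

  toricF-suc : ∀ v r → ρ v ≡ suc r →
    toricF v ≡ sumₚ (map (λ p → toricG p *ₚ x-1 ^ₚ (r ∸ ρ p))
                         (filter (_<? v) (allFin size)))
  toricF-suc v r ρv≡1+r =
    trans (toricF-unfold v)
      (trans (cong (λ s → toricSum v s (λ {p} _ → toricF p)) ρv≡1+r)
             (go (allFin size)))
    where
    gTerm : Carrier → Poly
    gTerm p = toricG p *ₚ x-1 ^ₚ (r ∸ ρ p)

    fTerm : ∀ p → Dec (p < v) → Poly
    fTerm = toricTerm r (λ {p} _ → toricF p)

    go : ∀ ps → sumₚ (map (λ p → fTerm p (p <? v)) ps) ≡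
                sumₚ (map gTerm (filter (_<? v) ps))
    go []       = refl
    go (p ∷ ps) = step (p <? v) refl
      where
      step : (p<?v : Dec (p < v)) → (p <? v) ≡ p<?v →
             sumₚ (map (λ p → fTerm p (p <? v)) (p ∷ ps)) ≡
             sumₚ (map gTerm (filter (_<? v) (p ∷ ps)))
      step (yes p<v) eq =
        trans (cong₂ _+ₚ_ (cong (fTerm p) eq) (go ps))
              (cong (sumₚ ∘ map gTerm) (sym (filter-accept (_<? v) p<v)))
      step (no p≮v) eq =
        trans (cong₂ _+ₚ_ (cong (fTerm p) eq) (go ps))
              (cong (sumₚ ∘ map gTerm) (sym (filter-reject (_<? v) p≮v)))

  -- For P of rank n + 1: the terms of xⁿ f([0̂,1̂),x⁻²), that is of
  -- Σᵢ ([xⁱ] f) xⁿ⁻²ⁱ, with nonnegative exponent n - 2i.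

  shortToric : ℕ → Poly
  shortToric n =
    sumₚ (map (λ i → coeff (toricF 1̂) i ·ₚ x^ (n ∸ 2 ℕ.* i)) (upTo (suc ⌊ n /2⌋)))

𝒞-monomial : ℕ → Poly
𝒞-monomial 0               = x^ 1
𝒞-monomial 1               = x^ 2
𝒞-monomial (suc m@(suc _)) = x^ (suc (suc m)) -ₚ x^ m

𝒟-monomial : ℕ → Poly
𝒟-monomial 0 = 1ₚ
𝒟-monomial 2 = -ₚ 1ₚ
𝒟-monomial _ = 0ₚ

𝒞 𝒟 : Operator
𝒞 = linearExtension 𝒞-monomial
𝒟 = linearExtension 𝒟-monomial

cd→operator : CD → Operator
cd→operator c = 𝒞
cd→operator d = 𝒟

infix 9 _ʳᵉᵛ⟨𝒞,𝒟⟩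
_ʳᵉᵛ⟨𝒞,𝒟⟩ : NCPoly CD → Operator
Φ ʳᵉᵛ⟨𝒞,𝒟⟩ = substituteOperators cd→operator (reverseWords Φ)

{-# OPTIONS --safe #-}

-- Unfolding Stanley's recursion along chains shows that f is a linear function of the flag
-- f-vector, hence of the ab-index, computed by reading ab-words from left to right: if F is the
-- value of a word of length m and G = (x - 1) F, then appending b gives minus the part of G of
-- degree at most m/2, and appending a gives the part of degree greater than m/2.  Appending
-- c = a + b or d = ab + ba keeps F palindromic, and on the short form xᵐ F(x⁻²), truncated to
-- nonnegative degrees, these two steps are the operators 𝒞 and 𝒟.

module Submission where

open import Defs
open import Data.Bool.Base using (if_then_else_)
open import Data.Fin.Base as Fin using (Fin; toℕ; inject₁; fromℕ)
open import Data.Fin.Induction using (po-noetherian)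
import Data.Fin.Properties as Fin
open import Data.Fin.Subset using (Subset; Side; inside; outside; ⊥; _⊂_; ∣_∣)
  renaming (_∈_ to _∈ˢ_; _∉_ to _∉ˢ_; _⊆_ to _⊆ˢ_)
open import Data.Fin.Subset.Properties using (_∈?_; _⊆?_; ∉⊥; p⊆q⇒∣p∣≤∣q∣)
open import Data.Integer.Base as ℤ using (ℤ; 1ℤ; -1ℤ)
import Data.Integer.Properties as ℤ
open import Data.List.Base as List
  using (List; []; _∷_; [_]; _++_; map; foldr; foldl; filter; reverse; upTo; applyUpTo; allFin; length)
open import Data.List.Membership.Propositional using (_∈_)
open import Data.List.Membership.Propositional.Properties
  using (∈-map⁺; ∈-++⁺ˡ; ∈-++⁺ʳ; ∈-upTo⁺; ∈-upTo⁻; ∈-allFin)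
import Data.List.Properties as List
open import Data.List.Relation.Unary.All as All using ()
open import Data.List.Relation.Unary.AllPairs using ([]; _∷_)
open import Data.List.Relation.Unary.Any using (here; there)
open import Data.List.Relation.Unary.Unique.Propositional using (Unique)
open import Data.List.Relation.Unary.Unique.Propositional.Properties using (upTo⁺; allFin⁺)
open import Data.Nat.Base as ℕ using (ℕ; zero; suc; _∸_; ⌊_/2⌋; z≤n; s≤s)
import Data.Nat.Properties as ℕ
open import Data.Product.Base using (_×_; _,_; ∃-syntax; proj₁; proj₂)
open import Data.Rational.Base using (ℚ; 0ℚ; 1ℚ; _+_; _*_; _-_; -_; _/_; toℚᵘ)
import Data.Rational.Properties as ℚ
open import Data.Rational.Solver using (module +-*-Solver)
open import Data.Rational.Unnormalised.Base as ℚᵘ using (mkℚᵘ; *≡*)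
import Data.Rational.Unnormalised.Properties as ℚᵘ
open import Data.Sum.Base as Sum using (_⊎_; inj₁; inj₂)
open import Data.Vec.Base as Vec using (_∷ʳ_; _[_]≔_; here; there)
import Data.Vec.Properties as Vec
open import Function.Base using (_∘_; id; flip)
open import Induction.WellFounded using (WellFounded; Acc; acc)
open import Level using (0ℓ)
import Relation.Binary.Construct.NonStrictToStrict as ToStrict
open import Relation.Binary.Core using (Rel)
open import Relation.Binary.Definitions using (DecidableEquality; tri<; tri≈; tri>)
  renaming (Decidable to Decidable₂)
open import Relation.Binary.PropositionalEquality hiding ([_]; isPartialOrder)
open import Relation.Binary.Structures using (IsDecPartialOrder)
open import Relation.Nullary
open import Relation.Nullary.Decidable using (map′; decidable-stable)
import Relation.Unary as U

open +-*-Solver using (solve; con; _:+_; _:*_; _:-_; :-_; _:=_)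

-- The operators have a simple origin. Passing from F to x^m F(x^(-2)) while m grows by one turns
-- multiplication by x - 1 into multiplication by 1/x - x, and the indices i with 2i ≤ m into the
-- positive exponents m + 1 - 2i. So `𝒞`, which is multiplication by x - 1/x with only positive
-- degrees kept, is the effect of appending b; appending a contributes only in degrees at most zero,
-- and its contribution in degree zero is killed by the symmetry of F. A single letter a or b
-- destroys palindromicity in general, so the induction over a cd-word must advance by whole letters
-- c and d. Reversal appears because the first letter read acts first, whereas in a composition the
-- last factor does. On the poset side the obstacle is that Stanley's recursion descends through
-- elements, while flag numbers are indexed by sets of ranks. The bridge is his sum cut off at rank
-- n, below an element of any larger rank: it and the weighted count of chains obey the same
-- recurrence in n.

private variable
  A B : Set
  n   : ℕ

-- Finite sums of rational numbers

∑ : List A → (A → ℚ) → ℚ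
∑ xs f = sumℚ (map f xs)

∑-cong : ∀ (xs : List A) {f g : A → ℚ} → (∀ x → f x ≡ g x) → ∑ xs f ≡ ∑ xs g
∑-cong xs f≗g = cong sumℚ (List.map-cong f≗g xs)

∑-zero : ∀ (xs : List A) {f : A → ℚ} → (∀ {x} → x ∈ xs → f x ≡ 0ℚ) → ∑ xs f ≡ 0ℚ
∑-zero []       f≡0 = refl
∑-zero (x ∷ xs) f≡0 = cong₂ _+_ (f≡0 (here refl)) (∑-zero xs (f≡0 ∘ there))

∑-++ : ∀ (xs ys : List A) (f : A → ℚ) → ∑ (xs ++ ys) f ≡ ∑ xs f + ∑ ys f
∑-++ []       ys f = sym (ℚ.+-identityˡ _)
∑-++ (x ∷ xs) ys f = trans (cong (f x +_) (∑-++ xs ys f)) (sym (ℚ.+-assoc (f x) _ _))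

∑-map : ∀ (h : A → B) (xs : List A) (f : B → ℚ) → ∑ (map h xs) f ≡ ∑ xs (f ∘ h)
∑-map h xs f = cong sumℚ (sym (List.map-∘ xs))

∑-+ : ∀ (xs : List A) (f g : A → ℚ) → ∑ xs (λ x → f x + g x) ≡ ∑ xs f + ∑ xs g
∑-+ []       f g = refl
∑-+ (x ∷ xs) f g = trans (cong (f x + g x +_) (∑-+ xs f g))
  (solve 4 (λ w x y z → (w :+ x) :+ (y :+ z) := (w :+ y) :+ (x :+ z)) refl (f x) (g x) _ _)

∑-*ˡ : ∀ (xs : List A) (q : ℚ) (f : A → ℚ) → ∑ xs (λ x → q * f x) ≡ q * ∑ xs f
∑-*ˡ []       q f = sym (ℚ.*-zeroʳ q)
∑-*ˡ (x ∷ xs) q f = trans (cong (q * f x +_) (∑-*ˡ xs q f)) (sym (ℚ.*-distribˡ-+ q _ _))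

∑-*ʳ : ∀ (xs : List A) (q : ℚ) (f : A → ℚ) → ∑ xs (λ x → f x * q) ≡ ∑ xs f * q
∑-*ʳ xs q f = trans (∑-cong xs (λ x → ℚ.*-comm (f x) q)) (trans (∑-*ˡ xs q f) (ℚ.*-comm q _))

∑-swap : ∀ (xs : List A) (ys : List B) (f : A → B → ℚ) →
         ∑ xs (λ x → ∑ ys (f x)) ≡ ∑ ys (λ y → ∑ xs (λ x → f x y))
∑-swap []       ys f = sym (∑-zero ys (λ _ → refl))
∑-swap (x ∷ xs) ys f = trans (cong (∑ ys (f x) +_) (∑-swap xs ys f)) (sym (∑-+ ys (f x) _))

∑-single : ∀ {xs : List A} {x} {f : A → ℚ} → Unique xs → x ∈ xs →
           (∀ {y} → y ∈ xs → y ≢ x → f y ≡ 0ℚ) → ∑ xs f ≡ f x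
∑-single {xs = x ∷ xs} {f = f} (x∉xs ∷ _) (here refl) f≡0 =
  trans (cong (f x +_) (∑-zero xs λ y∈xs → f≡0 (there y∈xs) (All.lookup x∉xs y∈xs ∘ sym)))
        (ℚ.+-identityʳ _)
∑-single {xs = x ∷ xs} (x∉xs ∷ uxs) (there y∈xs) f≡0 =
  trans (cong₂ _+_ (f≡0 (here refl) (All.lookup x∉xs y∈xs)) (∑-single uxs y∈xs (f≡0 ∘ there)))
        (ℚ.+-identityˡ _)

if-yes : ∀ {x y : ℚ} (A? : Dec A) → A → (if does A? then x else y) ≡ x
if-yes (yes _)  _ = refl
if-yes (no ¬p) p = contradiction p ¬p

if-no : ∀ {x y : ℚ} (A? : Dec A) → ¬ A → (if does A? then x else y) ≡ y
if-no (yes p) ¬p = contradiction p ¬p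
if-no (no _)  _  = refl

-- Coefficient sequences and linear functionals

Seq : Set
Seq = ℕ → ℚ

-- Sequences are functions and are compared pointwise, so respecting pointwise equality has to be a
-- field of its own.
record Linear (L : Seq → ℚ) : Set where
  field
    L-cong : ∀ {F G} → F ≗ G → L F ≡ L G
    L-+    : ∀ F G → L (λ i → F i + G i) ≡ L F + L G
    L-*    : ∀ q F → L (λ i → q * F i) ≡ q * L F

  L-∑ : ∀ (xs : List A) (q : A → ℚ) (F : A → Seq) →
        L (λ i → ∑ xs (λ x → q x * F x i)) ≡ ∑ xs (λ x → q x * L (F x))
  -- The zero sequence is rewritten as `0ℚ` times itself, so that `L-*` gives the value zero.
  L-∑ []       q F = trans (L-cong {G = λ i → 0ℚ * 0ℚ} λ _ → refl)
                           (trans (L-* 0ℚ (λ _ → 0ℚ)) (ℚ.*-zeroˡ (L (λ _ → 0ℚ))))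
  L-∑ (x ∷ xs) q F = trans (L-+ (λ i → q x * F x i) _) (cong₂ _+_ (L-* (q x) (F x)) (L-∑ xs q F))

  L-minus : ∀ F G → L (λ i → F i - G i) ≡ L F - L G
  L-minus F G = trans (L-cong λ i → eq (F i) (G i)) (trans (L-+ F _)
              (trans (cong (L F +_) (L-* (- 1ℚ) G)) (sym (eq (L F) (L G)))))
    where
    eq : ∀ x y → x - y ≡ x + - 1ℚ * y
    eq = solve 2 (λ x y → x :- y := x :+ con (- 1ℚ) :* y) refl

open Linear public

LinearOp : (Seq → Seq) → Set
LinearOp T = ∀ i → Linear (λ F → T F i)

Linear-∘ : ∀ {L T} → Linear L → LinearOp T → Linear (L ∘ T)
Linear-∘ {L} {T} lin linT = record
  { L-cong = λ F≗G → L-cong lin (λ i → L-cong (linT i) F≗G)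
  ; L-+    = λ F G → trans (L-cong lin (λ i → L-+ (linT i) F G)) (L-+ lin (T F) (T G))
  ; L-*    = λ q F → trans (L-cong lin (λ i → L-* (linT i) q F)) (L-* lin q (T F))
  }

Linear-resp : ∀ {L L′} → (∀ F → L F ≡ L′ F) → Linear L′ → Linear L
Linear-resp L≡L′ lin = record
  { L-cong = λ {F} {G} F≗G → trans (L≡L′ F) (trans (L-cong lin F≗G) (sym (L≡L′ G)))
  ; L-+    = λ F G → trans (L≡L′ _) (trans (L-+ lin F G) (sym (cong₂ _+_ (L≡L′ F) (L≡L′ G))))
  ; L-*    = λ q F → trans (L≡L′ _) (trans (L-* lin q F) (sym (cong (q *_) (L≡L′ F))))
  }

∑-linear : ∀ (xs : List A) {L : A → Seq → ℚ} → (∀ x → Linear (L x)) → Linear (λ F → ∑ xs (λ x → L x F))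
∑-linear xs {L} lin = record
  { L-cong = λ F≗G → ∑-cong xs (λ x → L-cong (lin x) F≗G)
  ; L-+    = λ F G → trans (∑-cong xs (λ x → L-+ (lin x) F G)) (∑-+ xs (λ x → L x F) (λ x → L x G))
  ; L-*    = λ q F → trans (∑-cong xs (λ x → L-* (lin x) q F)) (∑-*ˡ xs q (λ x → L x F))
  }

coordinate-linear : ∀ i q → Linear (λ F → F i * q)
coordinate-linear i q = record
  { L-cong = λ F≗G → cong (_* q) (F≗G i)
  ; L-+    = λ F G → ℚ.*-distribʳ-+ q (F i) (G i)
  ; L-*    = λ r F → ℚ.*-assoc r (F i) q
  }

-- Multiplication by x - 1.
δ : Seq → Seq
δ F zero    = - F zero
δ F (suc i) = F i - F (suc i)

δ-linear : LinearOp δ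
δ-linear zero = record
  { L-cong = λ F≗G → cong -_ (F≗G 0)
  ; L-+    = λ F G → ℚ.neg-distrib-+ (F 0) (G 0)
  ; L-*    = λ q F → ℚ.neg-distribʳ-* q (F 0)
  }
δ-linear (suc i) = record
  { L-cong = λ F≗G → cong₂ _-_ (F≗G i) (F≗G (suc i))
  ; L-+    = λ F G → solve 4 (λ w x y z → (w :+ x) :- (y :+ z) := (w :- y) :+ (x :- z)) refl
                       (F i) (G i) (F (suc i)) (G (suc i))
  ; L-*    = λ q F → solve 3 (λ q x y → q :* x :- q :* y := q :* (x :- y)) refl q (F i) (F (suc i))
  }

-- If F is the toric polynomial of an ab-word of length m, then stepᵃ m F and stepᵇ m F are
-- those of the words extended by a and by b on the right.
stepᵃ stepᵇ : ℕ → Seq → Seq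
stepᵃ m F i = if does (i ℕ.+ i ℕ.≤? m) then 0ℚ else δ F i
stepᵇ m F i = if does (i ℕ.+ i ℕ.≤? m) then - δ F i else 0ℚ

step : AB → ℕ → Seq → Seq
step a = stepᵃ
step b = stepᵇ

0-linear : Linear (λ _ → 0ℚ)
0-linear = record
  { L-cong = λ _ → refl ; L-+ = λ _ _ → refl ; L-* = λ q _ → sym (ℚ.*-zeroʳ q) }

neg-linear : ∀ {L} → Linear L → Linear (λ F → - L F)
neg-linear {L} lin = record
  { L-cong = λ F≗G → cong -_ (L-cong lin F≗G)
  ; L-+    = λ F G → trans (cong -_ (L-+ lin F G)) (ℚ.neg-distrib-+ (L F) (L G))
  ; L-*    = λ q F → trans (cong -_ (L-* lin q F)) (ℚ.neg-distribʳ-* q (L F))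
  }

if-linear : ∀ {L L′} (A? : Dec A) → Linear L → Linear L′ →
            Linear (λ F → if does A? then L F else L′ F)
if-linear (yes _) lin lin′ = lin
if-linear (no  _) lin lin′ = lin′

step-linear : ∀ x m → LinearOp (step x m)
step-linear a m i = if-linear (i ℕ.+ i ℕ.≤? m) 0-linear (δ-linear i)
step-linear b m i = if-linear (i ℕ.+ i ℕ.≤? m) (neg-linear (δ-linear i)) 0-linear

-- Coefficients of polynomials

coeff-+ : ∀ p q i → coeff (p +ₚ q) i ≡ coeff p i + coeff q i
coeff-+ []      q       i       = sym (ℚ.+-identityˡ _)
coeff-+ (x ∷ p) []      i       = sym (ℚ.+-identityʳ _)
coeff-+ (x ∷ p) (y ∷ q) zero    = refl
coeff-+ (x ∷ p) (y ∷ q) (suc i) = coeff-+ p q i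

coeff-· : ∀ q p i → coeff (q ·ₚ p) i ≡ q * coeff p i
coeff-· q []      i       = sym (ℚ.*-zeroʳ q)
coeff-· q (x ∷ p) zero    = refl
coeff-· q (x ∷ p) (suc i) = coeff-· q p i

coeff-neg : ∀ p i → coeff (-ₚ p) i ≡ - coeff p i
coeff-neg []      i       = refl
coeff-neg (x ∷ p) zero    = refl
coeff-neg (x ∷ p) (suc i) = coeff-neg p i

coeff-sum : ∀ (xs : List A) (p : A → Poly) i → coeff (sumₚ (map p xs)) i ≡ ∑ xs (λ x → coeff (p x) i)
coeff-sum []       p i = refl
coeff-sum (x ∷ xs) p i = trans (coeff-+ (p x) _ i) (cong (coeff (p x) i +_) (coeff-sum xs p i))

coeff-x^-same : ∀ m → coeff (x^ m) m ≡ 1ℚ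
coeff-x^-same zero    = refl
coeff-x^-same (suc m) = coeff-x^-same m

coeff-x^-other : ∀ m k → m ≢ k → coeff (x^ m) k ≡ 0ℚ
coeff-x^-other zero    zero    m≢k = contradiction refl m≢k
coeff-x^-other zero    (suc k) m≢k = refl
coeff-x^-other (suc m) zero    m≢k = refl
coeff-x^-other (suc m) (suc k) m≢k = coeff-x^-other m k (m≢k ∘ cong suc)

-- Short forms of coefficient sequences

shortPoly : ℕ → Seq → Poly
shortPoly m F = sumₚ (map (λ i → F i ·ₚ x^ (m ∸ 2 ℕ.* i)) (upTo (suc ⌊ m /2⌋)))

short : ℕ → ℕ → Seq → ℚ
short m k F = coeff (shortPoly m F) k

short-∑ : ∀ m k F → short m k F ≡ ∑ (upTo (suc ⌊ m /2⌋)) (λ i → F i * coeff (x^ (m ∸ 2 ℕ.* i)) k)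
short-∑ m k F = trans
  (coeff-sum (upTo (suc ⌊ m /2⌋)) (λ i → F i ·ₚ x^ (m ∸ 2 ℕ.* i)) k)
  (∑-cong (upTo (suc ⌊ m /2⌋)) λ i → coeff-· (F i) (x^ (m ∸ 2 ℕ.* i)) k)

short-linear : ∀ m k → Linear (short m k)
short-linear m k = Linear-resp (short-∑ m k)
  (∑-linear (upTo (suc ⌊ m /2⌋)) λ i → coordinate-linear i (coeff (x^ (m ∸ 2 ℕ.* i)) k))

≤-half : ∀ i m → i ℕ.+ i ℕ.≤ m → i ℕ.≤ ⌊ m /2⌋
≤-half i m i+i≤m = subst (ℕ._≤ ⌊ m /2⌋) (sym (ℕ.n≡⌊n+n/2⌋ i)) (ℕ.⌊n/2⌋-mono i+i≤m)

half-≤ : ∀ i m → i ℕ.≤ ⌊ m /2⌋ → i ℕ.+ i ℕ.≤ m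
half-≤ i m i≤ = ℕ.≤-trans (ℕ.+-mono-≤ i≤ (ℕ.≤-trans i≤ (ℕ.⌊n/2⌋≤⌈n/2⌉ m)))
                          (ℕ.≤-reflexive (ℕ.⌊n/2⌋+⌈n/2⌉≡n m))

double : ∀ i → 2 ℕ.* i ≡ i ℕ.+ i
double i = cong (i ℕ.+_) (ℕ.+-identityʳ i)

-- p is obtained from xᵐ F(x⁻²) by discarding the terms of negative degree.
record Short (m : ℕ) (F : Seq) (p : Poly) : Set where
  field
    on  : ∀ i k → i ℕ.+ i ℕ.+ k ≡ m → coeff p k ≡ F i
    off : ∀ k → (∀ i → i ℕ.+ i ℕ.+ k ≢ m) → coeff p k ≡ 0ℚ

shortPoly-Short : ∀ m F → Short m F (shortPoly m F)
shortPoly-Short m F = record { on = on ; off = off }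
  where
  ≤m : ∀ {i} → i ∈ upTo (suc ⌊ m /2⌋) → i ℕ.+ i ℕ.≤ m
  ≤m i∈ = half-≤ _ m (ℕ.≤-pred (∈-upTo⁻ i∈))

  term≡0 : ∀ {i k} → i ∈ upTo (suc ⌊ m /2⌋) → i ℕ.+ i ℕ.+ k ≢ m →
           F i * coeff (x^ (m ∸ 2 ℕ.* i)) k ≡ 0ℚ
  term≡0 {i} {k} i∈ ≢m = trans (cong (F i *_) (coeff-x^-other _ k λ eq → ≢m (begin
      i ℕ.+ i ℕ.+ k                  ≡⟨ cong (i ℕ.+ i ℕ.+_) (sym eq) ⟩
      i ℕ.+ i ℕ.+ (m ∸ 2 ℕ.* i)      ≡⟨ cong (λ j → i ℕ.+ i ℕ.+ (m ∸ j)) (double i) ⟩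
      i ℕ.+ i ℕ.+ (m ∸ (i ℕ.+ i))    ≡⟨ ℕ.m+[n∸m]≡n (≤m i∈) ⟩
      m                              ∎))) (ℚ.*-zeroʳ (F i))
    where open ≡-Reasoning

  off : ∀ k → (∀ i → i ℕ.+ i ℕ.+ k ≢ m) → coeff (shortPoly m F) k ≡ 0ℚ
  off k ≢m = trans (short-∑ m k F) (∑-zero _ λ {i} i∈ → term≡0 i∈ (≢m i))

  on : ∀ i k → i ℕ.+ i ℕ.+ k ≡ m → coeff (shortPoly m F) k ≡ F i
  on i k eq = trans (short-∑ m k F) (trans
    (∑-single (upTo⁺ _) (∈-upTo⁺ (s≤s (≤-half i m (subst (i ℕ.+ i ℕ.≤_) eq (ℕ.m≤m+n _ k)))))
      λ {j} j∈ j≢i → term≡0 {j} {k} j∈ λ eq′ → j≢i (trans (ℕ.n≡⌊n+n/2⌋ j) (trans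
        (cong ⌊_/2⌋ (ℕ.+-cancelʳ-≡ k _ _ (trans eq′ (sym eq)))) (sym (ℕ.n≡⌊n+n/2⌋ i)))))
    (trans (cong (λ j → F i * coeff (x^ j) k) exp)
      (trans (cong (F i *_) (coeff-x^-same k)) (ℚ.*-identityʳ _))))
    where
    exp : m ∸ 2 ℕ.* i ≡ k
    exp = trans (cong₂ _∸_ (sym eq) (double i)) (ℕ.m+n∸m≡n (i ℕ.+ i) k)

short-unique : ∀ {m F p} → Short m F p → ∀ k → short m k F ≡ coeff p k
-- The search for i can stop at m, since i + i + k ≡ m forces i ≤ m; this decides which of `on` and
-- `off` governs degree k.
short-unique {m} {F} {p} sh k with ℕ.anyUpTo? (λ i → i ℕ.+ i ℕ.+ k ℕ.≟ m) (suc m)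
... | yes (i , _ , eq) = trans (Short.on (shortPoly-Short m F) i k eq) (sym (Short.on sh i k eq))
... | no ∄i = trans (Short.off (shortPoly-Short m F) k ≢m) (sym (Short.off sh k ≢m))
  where
  ≢m : ∀ i → i ℕ.+ i ℕ.+ k ≢ m
  ≢m i eq = ∄i (i , s≤s (subst (i ℕ.≤_) eq (ℕ.≤-trans (ℕ.m≤m+n i i) (ℕ.m≤m+n _ k))) , eq)

-- Coefficients of the images under 𝒞 and 𝒟

pairing : (ℕ → ℚ) → Poly → ℚ
pairing v []      = 0ℚ
pairing v (q ∷ p) = q * v 0 + pairing (v ∘ suc) p

coeff-linearExtension : ∀ φ p k → coeff (linearExtension φ p) k ≡ pairing (λ m → coeff (φ m) k) p
coeff-linearExtension φ []      k = refl
coeff-linearExtension φ (q ∷ p) k = trans (coeff-+ (q ·ₚ φ 0) _ k)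
  (cong₂ _+_ (coeff-· q (φ 0) k) (coeff-linearExtension (φ ∘ suc) p k))

pairing-cong : ∀ {v w} → v ≗ w → ∀ p → pairing v p ≡ pairing w p
pairing-cong v≗w []      = refl
pairing-cong v≗w (q ∷ p) = cong₂ (λ x y → q * x + y) (v≗w 0) (pairing-cong (v≗w ∘ suc) p)

pairing-zero : ∀ p → pairing (λ _ → 0ℚ) p ≡ 0ℚ
pairing-zero []      = refl
pairing-zero (q ∷ p) = cong₂ _+_ (ℚ.*-zeroʳ q) (pairing-zero p)

pairing-minus : ∀ v w p → pairing (λ m → v m - w m) p ≡ pairing v p - pairing w p
pairing-minus v w []      = refl
pairing-minus v w (q ∷ p) = trans (cong (q * (v 0 - w 0) +_) (pairing-minus (v ∘ suc) (w ∘ suc) p))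
  (solve 5 (λ q w x y z → q :* (w :- x) :+ (y :- z) := (q :* w :+ y) :- (q :* x :+ z)) refl
     q (v 0) (w 0) (pairing (v ∘ suc) p) (pairing (w ∘ suc) p))

pairing-x^ : ∀ j p → pairing (coeff (x^ j)) p ≡ coeff p j
pairing-x^ j       []      = refl
pairing-x^ zero    (q ∷ p) = trans (cong₂ _+_ (ℚ.*-identityʳ q) (pairing-zero p)) (ℚ.+-identityʳ q)
pairing-x^ (suc j) (q ∷ p) = trans (cong₂ _+_ (ℚ.*-zeroʳ q) (pairing-x^ j p)) (ℚ.+-identityˡ _)

-- Coefficient k of the image is p paired with row k of the operator's matrix. As a function of m,
-- `coeff (x^ j) m` is the unit vector at j, and pairing with it reads off coefficient j of p. Every
-- nonzero row of `𝒞` and `𝒟` is a difference of two such unit vectors.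
coeff-linearExtension-difference : ∀ φ k j l →
  (∀ m → coeff (φ m) k ≡ coeff (x^ j) m - coeff (x^ l) m) →
  ∀ p → coeff (linearExtension φ p) k ≡ coeff p j - coeff p l
coeff-linearExtension-difference φ k j l eq p = trans (coeff-linearExtension φ p k)
  (trans (pairing-cong eq p) (trans (pairing-minus (coeff (x^ j)) (coeff (x^ l)) p)
    (cong₂ _-_ (pairing-x^ j p) (pairing-x^ l p))))

coeff-linearExtension-zero : ∀ φ k → (∀ m → coeff (φ m) k ≡ 0ℚ) →
  ∀ p → coeff (linearExtension φ p) k ≡ 0ℚ
coeff-linearExtension-zero φ k eq p =
  trans (coeff-linearExtension φ p k) (trans (pairing-cong eq p) (pairing-zero p))

coeff-x^-sym : ∀ m k → coeff (x^ m) k ≡ coeff (x^ k) m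
coeff-x^-sym zero    zero    = refl
coeff-x^-sym zero    (suc k) = refl
coeff-x^-sym (suc m) zero    = refl
coeff-x^-sym (suc m) (suc k) = coeff-x^-sym m k

coeff-x^-difference : ∀ m l k → coeff (x^ m -ₚ x^ l) k ≡ coeff (x^ k) m - coeff (x^ k) l
coeff-x^-difference m l k = trans (coeff-+ (x^ m) _ k)
  (cong₂ _+_ (coeff-x^-sym m k) (trans (coeff-neg (x^ l) k) (cong -_ (coeff-x^-sym l k))))

𝒞-zero : ∀ p → coeff (𝒞 p) 0 ≡ 0ℚ
𝒞-zero = coeff-linearExtension-zero 𝒞-monomial 0 λ where
  0                   → refl
  1                   → refl
  (suc (suc m))       → refl

-- With `𝒞-zero` this exhibits `𝒞` as multiplication by x - 1/x followed by discarding all degrees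
-- at most zero.
𝒞-suc : ∀ k p → coeff (𝒞 p) (suc k) ≡ coeff p k - coeff p (suc (suc k))
𝒞-suc k = coeff-linearExtension-difference 𝒞-monomial (suc k) k (suc (suc k)) λ where
  0                   → trans (coeff-x^-sym 0 k) (sym (ℚ.+-identityʳ _))
  1                   → trans (coeff-x^-sym 1 k) (sym (ℚ.+-identityʳ _))
  (suc (suc m))       → coeff-x^-difference (suc (suc (suc m))) (suc m) (suc k)

-- This is the difference that `𝒞-suc` puts in degree one; `𝒟` keeps only that one and moves it to
-- degree zero.
𝒟-zero : ∀ p → coeff (𝒟 p) 0 ≡ coeff p 0 - coeff p 2
𝒟-zero = coeff-linearExtension-difference 𝒟-monomial 0 0 2 λ where
  0                   → refl
  1                   → refl
  2                   → refl
  (suc (suc (suc m))) → refl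

𝒟-suc : ∀ k p → coeff (𝒟 p) (suc k) ≡ 0ℚ
𝒟-suc k = coeff-linearExtension-zero 𝒟-monomial (suc k) λ where
  0                   → refl
  1                   → refl
  2                   → refl
  (suc (suc (suc m))) → refl

-- The steps by c = a + b and by d = ab + ba

stepᶜ stepᵈ : ℕ → Seq → Seq
stepᶜ m F i = stepᵃ m F i + stepᵇ m F i
stepᵈ m F i = stepᵇ (suc m) (stepᵃ m F) i + stepᵃ (suc m) (stepᵇ m F) i

record Palindromic (m : ℕ) (F : Seq) : Set where
  field
    symmetric : ∀ i j → i ℕ.+ j ≡ m → F i ≡ F j
    bounded   : ∀ i → m ℕ.< i → F i ≡ 0ℚ

open Palindromic

module _ {m : ℕ} {F : Seq} where

  stepᵃ-low : ∀ i → i ℕ.+ i ℕ.≤ m → stepᵃ m F i ≡ 0ℚ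
  stepᵃ-low i = if-yes (i ℕ.+ i ℕ.≤? m)

  stepᵃ-high : ∀ i → ¬ i ℕ.+ i ℕ.≤ m → stepᵃ m F i ≡ δ F i
  stepᵃ-high i = if-no (i ℕ.+ i ℕ.≤? m)

  stepᵇ-low : ∀ i → i ℕ.+ i ℕ.≤ m → stepᵇ m F i ≡ - δ F i
  stepᵇ-low i = if-yes (i ℕ.+ i ℕ.≤? m)

  stepᵇ-high : ∀ i → ¬ i ℕ.+ i ℕ.≤ m → stepᵇ m F i ≡ 0ℚ
  stepᵇ-high i = if-no (i ℕ.+ i ℕ.≤? m)

  stepᶜ-low : ∀ i → i ℕ.+ i ℕ.≤ m → stepᶜ m F i ≡ - δ F i
  stepᶜ-low i low = trans (cong₂ _+_ (stepᵃ-low i low) (stepᵇ-low i low)) (ℚ.+-identityˡ (- δ F i))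

  stepᶜ-high : ∀ i → ¬ i ℕ.+ i ℕ.≤ m → stepᶜ m F i ≡ δ F i
  stepᶜ-high i high = trans (cong₂ _+_ (stepᵃ-high i high) (stepᵇ-high i high)) (ℚ.+-identityʳ (δ F i))

  module _ (pal : Palindromic m F) where

    -- The product of a palindromic F and the antipalindromic x - 1 is antisymmetric under i ↦ m + 1
    -- - i. `stepᶜ` changes the sign of exactly the lower half, which makes it symmetric.
    stepᶜ-mirror : ∀ {i j} → i ℕ.< j → i ℕ.+ j ≡ suc m → stepᶜ m F i ≡ stepᶜ m F j
    stepᶜ-mirror {i} {suc j} i<j i+j≡1+m = trans (stepᶜ-low i low)
      (trans (antisymmetric i i+j≡m) (sym (stepᶜ-high (suc j) high)))
      where
      i+j≡m : i ℕ.+ j ≡ m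
      i+j≡m = ℕ.suc-injective (trans (sym (ℕ.+-suc i j)) i+j≡1+m)

      low : i ℕ.+ i ℕ.≤ m
      low = subst (i ℕ.+ i ℕ.≤_) i+j≡m (ℕ.+-monoʳ-≤ i (ℕ.≤-pred i<j))

      high : ¬ suc j ℕ.+ suc j ℕ.≤ m
      high = ℕ.<⇒≱ (subst (ℕ._≤ suc j ℕ.+ suc j) i+j≡1+m (ℕ.+-monoˡ-≤ (suc j) (ℕ.<⇒≤ i<j)))

      antisymmetric : ∀ i → i ℕ.+ j ≡ m → - δ F i ≡ δ F (suc j)
      -- The missing coefficient below `F 0` is matched by `F (suc j)`, which lies beyond degree m
      -- and vanishes.
      antisymmetric zero eq = begin
        - (- F 0)         ≡⟨ solve 1 (λ x → :- (:- x) := x :- con 0ℚ) refl (F 0) ⟩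
        F 0 - 0ℚ          ≡⟨ cong₂ _-_ (symmetric pal 0 j eq)
                               (sym (bounded pal (suc j) (ℕ.≤-reflexive (cong suc (sym eq))))) ⟩
        F j - F (suc j)   ∎
        where open ≡-Reasoning
      antisymmetric (suc i) eq = begin
        - (F i - F (suc i))   ≡⟨ solve 2 (λ x y → :- (x :- y) := y :- x) refl (F i) (F (suc i)) ⟩
        F (suc i) - F i       ≡⟨ cong₂ _-_ (symmetric pal (suc i) j eq)
                                   (symmetric pal i (suc j) (trans (ℕ.+-suc i j) eq)) ⟩
        F j - F (suc j)       ∎
        where open ≡-Reasoning

    stepᶜ-palindromic : Palindromic (suc m) (stepᶜ m F)
    stepᶜ-palindromic .symmetric i j i+j≡1+m with ℕ.<-cmp i j
    ... | tri< i<j _ _  = stepᶜ-mirror i<j i+j≡1+m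
    ... | tri≈ _ refl _ = refl
    ... | tri> _ _ j<i  = sym (stepᶜ-mirror j<i (trans (ℕ.+-comm j i) i+j≡1+m))
    stepᶜ-palindromic .bounded (suc i) (s≤s m<i) = trans
      (stepᶜ-high (suc i) (ℕ.<⇒≱ (ℕ.<-≤-trans (ℕ.m<n⇒m<1+n m<i) (ℕ.m≤m+n (suc i) (suc i)))))
      (cong₂ _-_ (bounded pal i m<i) (bounded pal (suc i) (ℕ.m<n⇒m<1+n m<i)))

    stepᵈ-middle : ∀ i → i ℕ.+ i ≡ m → stepᵈ m F (suc i) ≡ - δ F i
    stepᵈ-middle i refl = begin
      stepᵇ (suc m) (stepᵃ m F) (suc i) + stepᵃ (suc m) (stepᵇ m F) (suc i)
        ≡⟨ cong₂ _+_ (if-no (suc i ℕ.+ suc i ℕ.≤? suc m) high) (if-no (suc i ℕ.+ suc i ℕ.≤? suc m) high) ⟩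
      0ℚ + (stepᵇ m F i - stepᵇ m F (suc i))
        ≡⟨ cong₂ (λ x y → 0ℚ + (x - y)) (stepᵇ-low i ℕ.≤-refl) (stepᵇ-high (suc i) (high ∘ ℕ.m≤n⇒m≤1+n)) ⟩
      0ℚ + (- δ F i - 0ℚ)
        ≡⟨ solve 1 (λ x → con 0ℚ :+ (x :- con 0ℚ) := x) refl (- δ F i) ⟩
      - δ F i ∎
      where
      open ≡-Reasoning
      high : ¬ suc i ℕ.+ suc i ℕ.≤ suc m
      high = ℕ.<⇒≱ (s≤s (ℕ.≤-reflexive (sym (ℕ.+-suc i i))))

    -- `stepᵃ m F` starts above m/2 and the following `stepᵇ` keeps indices up to (m + 1)/2, so ab
    -- could survive only at 2i = m + 1; there the coefficient involves F at i - 1 and i, which are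
    -- equal by symmetry. Conversely `stepᵇ m F` ends at m/2, and multiplication by x - 1 spreads it
    -- by one index, so after the second truncation ba survives only at 2i = m + 2.
    stepᵈ-off-middle : ∀ i → i ℕ.+ i ≢ suc (suc m) → stepᵈ m F i ≡ 0ℚ
    stepᵈ-off-middle i off with i ℕ.+ i ℕ.≤? suc m
    ... | yes low = cong₂ _+_ (trans (if-yes (i ℕ.+ i ℕ.≤? suc m) low) (cong -_ (vanish i low)))
                              (if-yes (i ℕ.+ i ℕ.≤? suc m) low)
      where
      vanish : ∀ i → i ℕ.+ i ℕ.≤ suc m → δ (stepᵃ m F) i ≡ 0ℚ
      vanish zero    _   = cong -_ (stepᵃ-low 0 z≤n)
      vanish (suc i) low = cong₂ _-_ (stepᵃ-low i 2i≤m) next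
        where
        2+2i≤1+m : suc (suc (i ℕ.+ i)) ℕ.≤ suc m
        2+2i≤1+m = subst (ℕ._≤ suc m) (cong suc (ℕ.+-suc i i)) low

        2i≤m : i ℕ.+ i ℕ.≤ m
        2i≤m = ℕ.<⇒≤ (ℕ.≤-pred 2+2i≤1+m)

        next : stepᵃ m F (suc i) ≡ 0ℚ
        next with suc i ℕ.+ suc i ℕ.≤? m
        ... | yes low′ = stepᵃ-low (suc i) low′
        ... | no  high = trans (stepᵃ-high (suc i) high)
          (trans (cong (_- F (suc i)) (symmetric pal i (suc i) i+1+i≡m)) (ℚ.+-inverseʳ (F (suc i))))
          where
          i+1+i≡m : i ℕ.+ suc i ≡ m
          i+1+i≡m = ℕ.suc-injective (ℕ.≤-antisym low (ℕ.≰⇒> high))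
    ... | no high = cong₂ _+_ (if-no (i ℕ.+ i ℕ.≤? suc m) high)
                              (trans (if-no (i ℕ.+ i ℕ.≤? suc m) high) (vanish i off high))
      where
      vanish : ∀ i → i ℕ.+ i ≢ suc (suc m) → ¬ i ℕ.+ i ℕ.≤ suc m → δ (stepᵇ m F) i ≡ 0ℚ
      vanish zero    _   high = contradiction z≤n high
      vanish (suc i) off high =
        cong₂ _-_ (stepᵇ-high i 2i≰m) (stepᵇ-high (suc i) (high ∘ ℕ.m≤n⇒m≤1+n))
        where
        2i≰m : ¬ i ℕ.+ i ℕ.≤ m
        2i≰m 2i≤m = off (ℕ.≤-antisym
          (subst (ℕ._≤ suc (suc m)) (cong suc (sym (ℕ.+-suc i i))) (s≤s (s≤s 2i≤m))) (ℕ.≰⇒> high))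

    stepᵈ-palindromic : Palindromic (suc (suc m)) (stepᵈ m F)
    stepᵈ-palindromic .symmetric i j i+j≡2+m with i ℕ.≟ j
    ... | yes refl = refl
    ... | no  i≢j  = trans
      (stepᵈ-off-middle i λ 2i≡2+m → i≢j (ℕ.+-cancelˡ-≡ i i j (trans 2i≡2+m (sym i+j≡2+m))))
      (sym (stepᵈ-off-middle j λ 2j≡2+m → i≢j (ℕ.+-cancelʳ-≡ j i j (trans i+j≡2+m (sym 2j≡2+m)))))
    stepᵈ-palindromic .bounded i 2+m<i = stepᵈ-off-middle i λ 2i≡2+m →
      ℕ.<-irrefl (sym 2i≡2+m) (ℕ.<-≤-trans 2+m<i (ℕ.m≤m+n i i))

    module _ {p : Poly} (sh : Short m F p) where

      private
        diagonal : ∀ i k → suc i ℕ.+ suc i ℕ.+ k ≡ i ℕ.+ i ℕ.+ suc (suc k)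
        diagonal i k = begin
          suc (i ℕ.+ suc i ℕ.+ k)    ≡⟨ cong (λ j → suc (j ℕ.+ k)) (ℕ.+-suc i i) ⟩
          suc (suc (i ℕ.+ i ℕ.+ k))  ≡⟨ cong suc (sym (ℕ.+-suc (i ℕ.+ i) k)) ⟩
          suc (i ℕ.+ i ℕ.+ suc k)    ≡⟨ sym (ℕ.+-suc (i ℕ.+ i) (suc k)) ⟩
          i ℕ.+ i ℕ.+ suc (suc k)    ∎
          where open ≡-Reasoning

        -- Raising the exponent by two lowers the index by one, so a difference of coefficients of p
        -- two degrees apart is a difference of neighbouring coefficients of F. For index zero,
        -- degree k + 2 exceeds m and p has no term there.
        coeff-difference : ∀ i k → i ℕ.+ i ℕ.+ k ≡ m → coeff p k - coeff p (suc (suc k)) ≡ - δ F i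
        coeff-difference zero k k≡m = begin
          coeff p k - coeff p (suc (suc k))
            ≡⟨ cong₂ _-_ (Short.on sh 0 k k≡m) (Short.off sh (suc (suc k)) λ j eq →
                 ℕ.<⇒≱ (ℕ.n<1+n k) (ℕ.<⇒≤ (ℕ.≤-trans (ℕ.m≤n+m (suc (suc k)) (j ℕ.+ j))
                   (ℕ.≤-reflexive (trans eq (sym k≡m)))))) ⟩
          F 0 - 0ℚ
            ≡⟨ solve 1 (λ x → x :- con 0ℚ := :- (:- x)) refl (F 0) ⟩
          - (- F 0) ∎
          where open ≡-Reasoning
        coeff-difference (suc i) k eq = begin
          coeff p k - coeff p (suc (suc k))
            ≡⟨ cong₂ _-_ (Short.on sh (suc i) k eq)
                 (Short.on sh i (suc (suc k)) (trans (sym (diagonal i k)) eq)) ⟩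
          F (suc i) - F i
            ≡⟨ solve 2 (λ x y → y :- x := :- (x :- y)) refl (F i) (F (suc i)) ⟩
          - (F i - F (suc i)) ∎
          where open ≡-Reasoning

        coeff-difference-off : ∀ k → (∀ i → i ℕ.+ i ℕ.+ k ≢ m) →
                               coeff p k - coeff p (suc (suc k)) ≡ 0ℚ
        coeff-difference-off k off = cong₂ _-_ (Short.off sh k off)
          (Short.off sh (suc (suc k)) λ i eq → off (suc i) (trans (diagonal i k) eq))

      𝒞-Short : Short (suc m) (stepᶜ m F) (𝒞 p)
      𝒞-Short .Short.on zero    zero ()
      -- Exponent zero is the index just above the middle. Its coefficient comes from appending a
      -- and is a difference of two mirror coefficients of F, in agreement with the missing constant
      -- term of `𝒞 p`.
      𝒞-Short .Short.on (suc i) zero eq = begin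
        coeff (𝒞 p) 0      ≡⟨ 𝒞-zero p ⟩
        0ℚ                 ≡⟨ sym (ℚ.+-inverseʳ (F (suc i))) ⟩
        F (suc i) - F (suc i) ≡⟨ cong (_- F (suc i)) (sym (symmetric pal i (suc i) i+1+i≡m)) ⟩
        δ F (suc i)        ≡⟨ sym (stepᶜ-high (suc i) (ℕ.<⇒≱ (ℕ.≤-reflexive (sym 2i≡1+m)))) ⟩
        stepᶜ m F (suc i)  ∎
        where
        open ≡-Reasoning
        2i≡1+m : suc i ℕ.+ suc i ≡ suc m
        2i≡1+m = trans (sym (ℕ.+-identityʳ _)) eq
        i+1+i≡m : i ℕ.+ suc i ≡ m
        i+1+i≡m = ℕ.suc-injective 2i≡1+m
      𝒞-Short .Short.on i (suc k) eq = trans (𝒞-suc k p)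
        (trans (coeff-difference i k 2i+k≡m) (sym (stepᶜ-low i (subst (i ℕ.+ i ℕ.≤_) 2i+k≡m (ℕ.m≤m+n _ k)))))
        where
        2i+k≡m : i ℕ.+ i ℕ.+ k ≡ m
        2i+k≡m = ℕ.suc-injective (trans (sym (ℕ.+-suc (i ℕ.+ i) k)) eq)
      𝒞-Short .Short.off zero    off = 𝒞-zero p
      𝒞-Short .Short.off (suc k) off = trans (𝒞-suc k p) (coeff-difference-off k λ i eq →
        off i (trans (ℕ.+-suc (i ℕ.+ i) k) (cong suc eq)))

      𝒟-Short : Short (suc (suc m)) (stepᵈ m F) (𝒟 p)
      𝒟-Short .Short.on zero    zero ()
      𝒟-Short .Short.on (suc i) zero eq = trans (𝒟-zero p)
        (trans (coeff-difference i 0 (trans (ℕ.+-identityʳ _) 2i≡m)) (sym (stepᵈ-middle i 2i≡m)))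
        where
        2i≡m : i ℕ.+ i ≡ m
        2i≡m = ℕ.suc-injective (ℕ.suc-injective
          (trans (cong suc (sym (ℕ.+-suc i i))) (trans (sym (ℕ.+-identityʳ _)) eq)))
      𝒟-Short .Short.on i (suc k) eq = trans (𝒟-suc k p) (sym (stepᵈ-off-middle i λ 2i≡2+m →
        ℕ.m≢1+m+n (i ℕ.+ i) (trans 2i≡2+m (trans (sym eq) (ℕ.+-suc (i ℕ.+ i) k)))))
      𝒟-Short .Short.off zero    off = trans (𝒟-zero p) (coeff-difference-off 0 λ i eq →
        off (suc i) (cong suc (trans (cong (ℕ._+ 0) (ℕ.+-suc i i)) (cong suc eq))))
      𝒟-Short .Short.off (suc k) off = 𝒟-suc k p

-- Linear functionals on noncommutative polynomials

eval : {X : Set} → (List X → ℚ) → NCPoly X → ℚ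
eval L Φ = ∑ Φ (λ (q , w) → q * L w)

module _ {X : Set} (_≟_ : DecidableEquality X) where

  private
    _∖_ : (List X → ℚ) → List X → List X → ℚ
    (L ∖ w) v = if does (List.≡-dec _≟_ v w) then 0ℚ else L v

    eval-∖ : ∀ L w Φ → eval L Φ ≡ wordCoeff _≟_ Φ w * L w + eval (L ∖ w) Φ
    eval-∖ L w Φ = trans (∑-cong Φ (λ (q , v) → split q v (List.≡-dec _≟_ v w)))
      (trans (∑-+ Φ _ _) (cong (_+ eval (L ∖ w) Φ) (∑-*ʳ Φ (L w) _)))
      where
      split : ∀ q v (v≟w : Dec (v ≡ w)) →
              q * L v ≡ (if does v≟w then q else 0ℚ) * L w + q * (if does v≟w then 0ℚ else L v)
      split q v (yes refl) = solve 2 (λ x y → x :* y := x :* y :+ x :* con 0ℚ) refl q (L v)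
      split q v (no  _)    = solve 3 (λ x y z → x :* y := con 0ℚ :* z :+ x :* y) refl q (L v) (L w)

    -- `EqNC` compares total coefficients of words, whereas `eval` adds term by term and a word may
    -- be repeated. The induction therefore collects all occurrences of one word w at a time and
    -- replaces L by a functional vanishing at w, until L vanishes on every word present.
    eval-cong-support : ∀ ws L Φ Ψ → EqNC _≟_ Φ Ψ →
      (∀ {q w} → (q , w) ∈ Φ ++ Ψ → w ∈ ws ⊎ L w ≡ 0ℚ) → eval L Φ ≡ eval L Ψ
    eval-cong-support [] L Φ Ψ Φ≈Ψ supp =
      trans (∑-zero Φ (λ {t} → vanish t ∘ supp ∘ ∈-++⁺ˡ)) (sym (∑-zero Ψ (λ {t} → vanish t ∘ supp ∘ ∈-++⁺ʳ Φ)))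
      where
      vanish : ∀ ((q , w) : ℚ × List X) → w ∈ [] ⊎ L w ≡ 0ℚ → q * L w ≡ 0ℚ
      vanish (q , w) (inj₂ Lw≡0) = trans (cong (q *_) Lw≡0) (ℚ.*-zeroʳ q)
    eval-cong-support (w ∷ ws) L Φ Ψ Φ≈Ψ supp = trans (eval-∖ L w Φ)
      (trans (cong₂ (λ x y → x * L w + y) (Φ≈Ψ w)
                    (eval-cong-support ws (L ∖ w) Φ Ψ Φ≈Ψ (λ {q} {v} → restrict v ∘ supp)))
             (sym (eval-∖ L w Ψ)))
      where
      restrict : ∀ v → v ∈ w ∷ ws ⊎ L v ≡ 0ℚ → v ∈ ws ⊎ (L ∖ w) v ≡ 0ℚ
      restrict v s with List.≡-dec _≟_ v w
      restrict v s                    | yes _   = inj₂ refl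
      restrict v (inj₁ (here v≡w))    | no  v≢w = contradiction v≡w v≢w
      restrict v (inj₁ (there v∈ws))  | no  _   = inj₁ v∈ws
      restrict v (inj₂ Lv≡0)          | no  _   = inj₂ Lv≡0

  eval-EqNC : ∀ L Φ Ψ → EqNC _≟_ Φ Ψ → eval L Φ ≡ eval L Ψ
  eval-EqNC L Φ Ψ Φ≈Ψ = eval-cong-support (map proj₂ (Φ ++ Ψ)) L Φ Ψ Φ≈Ψ (inj₁ ∘ ∈-map⁺ proj₂)

module _ {X : Set} (L : List X → ℚ) where

  eval-· : ∀ q Φ → eval L (q ·ₙ Φ) ≡ q * eval L Φ
  eval-· q Φ = trans (∑-map _ Φ _) (trans (∑-cong Φ (λ (r , w) → ℚ.*-assoc q r (L w))) (∑-*ˡ Φ q _))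

  eval-∷-* : ∀ q w Φ Ψ → eval L (((q , w) ∷ Φ) *ₙ Ψ) ≡ q * eval (L ∘ (w ++_)) Ψ + eval L (Φ *ₙ Ψ)
  eval-∷-* q w Φ Ψ = trans (∑-++ (map _ Ψ) (Φ *ₙ Ψ) _) (cong (_+ eval L (Φ *ₙ Ψ))
    (trans (∑-map _ Ψ _) (trans (∑-cong Ψ (λ (r , v) → ℚ.*-assoc q r (L (w ++ v)))) (∑-*ˡ Ψ q _))))

  -- Both `cd→ab c` and `cd→ab d` compute to two words with coefficient one, so this covers both
  -- letters.
  eval-pair-* : ∀ v w Ψ → eval L (((1ℚ , v) ∷ (1ℚ , w) ∷ []) *ₙ Ψ) ≡
                eval (L ∘ (v ++_)) Ψ + eval (L ∘ (w ++_)) Ψ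
  eval-pair-* v w Ψ = trans (eval-∷-* 1ℚ v [ (1ℚ , w) ] Ψ) (trans
    (cong (1ℚ * eval (L ∘ (v ++_)) Ψ +_) (eval-∷-* 1ℚ w [] Ψ))
    (solve 2 (λ x y → con 1ℚ :* x :+ (con 1ℚ :* y :+ con 0ℚ) := x :+ y) refl
       (eval (L ∘ (v ++_)) Ψ) (eval (L ∘ (w ++_)) Ψ)))

  eval-substitute : ∀ {Y} (σ : Y → NCPoly X) Φ →
    eval L (substitute σ Φ) ≡ eval (λ w → eval L (foldr _*ₙ_ 1ₙ (map σ w))) Φ
  eval-substitute σ []            = refl
  eval-substitute σ ((q , w) ∷ Φ) =
    trans (∑-++ (q ·ₙ foldr _*ₙ_ 1ₙ (map σ w)) (substitute σ Φ) _)
          (cong₂ _+_ (eval-· q (foldr _*ₙ_ 1ₙ (map σ w))) (eval-substitute σ Φ))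

-- Short forms of ab-words and of expanded cd-words

shortWord : ℕ → ℕ → List AB → Seq → ℚ
shortWord m k []      = short m k
shortWord m k (x ∷ w) = shortWord (suc m) k w ∘ step x m

shortWord-linear : ∀ m k w → Linear (shortWord m k w)
shortWord-linear m k []      = short-linear m k
shortWord-linear m k (x ∷ w) = Linear-∘ (shortWord-linear (suc m) k w) (step-linear x m)

-- After a leading c or d is expanded, the same remainder is evaluated from two starting sequences.
-- Linearity in the start merges them into one, namely `stepᶜ m F` or `stepᵈ m F`.
eval-shortWord-+ : ∀ m k Φ F G →
  eval (λ w → shortWord m k w F) Φ + eval (λ w → shortWord m k w G) Φ ≡
  eval (λ w → shortWord m k w (λ i → F i + G i)) Φ
eval-shortWord-+ m k Φ F G = sym (trans
  (∑-cong Φ (λ (q , w) → trans (cong (q *_) (L-+ (shortWord-linear m k w) F G))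
                               (ℚ.*-distribˡ-+ q (shortWord m k w F) (shortWord m k w G))))
  (∑-+ Φ _ _))

expand : List CD → NCPoly AB
expand w = foldr _*ₙ_ 1ₙ (map cd→ab w)

act : List CD → Operator
act []      p = p
act (x ∷ w) p = act w (cd→operator x p)

-- The pair of F and its short form p is the invariant: consuming a letter of the cd-word advances F
-- by `stepᶜ` or `stepᵈ` and p by `𝒞` or `𝒟`, and palindromicity is restored each time.
eval-expand : ∀ {m F p} k w → Palindromic m F → Short m F p →
              eval (λ v → shortWord m k v F) (expand w) ≡ coeff (act w p) k
eval-expand {m} {F} {p} k [] pal sh = trans
  (solve 1 (λ x → con 1ℚ :* x :+ con 0ℚ := x) refl (short m k F)) (short-unique sh k)
eval-expand {m} {F} {p} k (c ∷ w) pal sh = trans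
  (eval-pair-* _ [ a ] [ b ] (expand w))
  (trans (eval-shortWord-+ (suc m) k (expand w) (stepᵃ m F) (stepᵇ m F))
         (eval-expand k w (stepᶜ-palindromic pal) (𝒞-Short pal sh)))
eval-expand {m} {F} {p} k (d ∷ w) pal sh = trans
  (eval-pair-* _ (a ∷ [ b ]) (b ∷ [ a ]) (expand w))
  (trans (eval-shortWord-+ (suc (suc m)) k (expand w) _ _)
         (eval-expand k w (stepᵈ-palindromic pal) (𝒟-Short pal sh)))

foldl-∘ : ∀ (h : Operator) w p → foldl (λ h x → cd→operator x ∘ h) h w p ≡ act w (h p)
foldl-∘ h []      p = refl
foldl-∘ h (x ∷ w) p = foldl-∘ (cd→operator x ∘ h) w p

coeff-ʳᵉᵛ⟨𝒞,𝒟⟩ : ∀ Φ p k → coeff ((Φ ʳᵉᵛ⟨𝒞,𝒟⟩) p) k ≡ eval (λ w → coeff (act w p) k) Φ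
coeff-ʳᵉᵛ⟨𝒞,𝒟⟩ Φ p k = trans (coeff-sum (reverseWords Φ) _ k) (trans (∑-map _ Φ _)
  (∑-cong Φ (λ (q , w) → trans (coeff-· q (foldr (λ x → cd→operator x ∘_) id (reverse w) p) k) (cong (λ r → q * coeff r k)
    -- A right fold over the reversed word is a left fold over the word itself, so its first letter
    -- is applied first, as in `act`.
    (trans (cong (λ h → h p) (List.reverse-foldr _ id w)) (foldl-∘ id w p))))))

coeff-1ₚ-palindromic : Palindromic 0 (coeff 1ₚ)
coeff-1ₚ-palindromic .symmetric zero    zero    _  = refl
coeff-1ₚ-palindromic .bounded   (suc i) _ = refl

1ₚ-Short : Short 0 (coeff 1ₚ) 1ₚ
1ₚ-Short .Short.on zero zero _    = refl
1ₚ-Short .Short.off zero    off = contradiction refl (off 0)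
1ₚ-Short .Short.off (suc k) off = refl

eval-shortWord-substitute : ∀ Φ k →
  eval (λ w → shortWord 0 k w (coeff 1ₚ)) (substitute cd→ab Φ) ≡ coeff ((Φ ʳᵉᵛ⟨𝒞,𝒟⟩) 1ₚ) k
eval-shortWord-substitute Φ k = trans (eval-substitute _ cd→ab Φ) (trans
  (∑-cong Φ (λ (q , w) → cong (q *_) (eval-expand k w coeff-1ₚ-palindromic 1ₚ-Short)))
  (sym (coeff-ʳᵉᵛ⟨𝒞,𝒟⟩ Φ 1ₚ k)))

-- Integers as rational numbers

ι : ℤ → ℚ
ι z = z / 1

-- The quotient `z / 1` is stored in normalised form; arithmetic identities are checked on
-- unnormalised fractions, where denominator one is visible.
toℚᵘ-ι : ∀ z → toℚᵘ (ι z) ℚᵘ.≃ mkℚᵘ z 0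
toℚᵘ-ι z = ℚ.toℚᵘ-fromℚᵘ (mkℚᵘ z 0)

ι-+ : ∀ y z → ι (y ℤ.+ z) ≡ ι y + ι z
ι-+ y z = ℚ.toℚᵘ-injective (begin
  toℚᵘ (ι (y ℤ.+ z))              ≈⟨ toℚᵘ-ι (y ℤ.+ z) ⟩
  mkℚᵘ (y ℤ.+ z) 0                ≈⟨ *≡* (cong (ℤ._* 1ℤ) (sym (cong₂ ℤ._+_ (ℤ.*-identityʳ y) (ℤ.*-identityʳ z)))) ⟩
  mkℚᵘ y 0 ℚᵘ.+ mkℚᵘ z 0          ≈⟨ ℚᵘ.+-cong (toℚᵘ-ι y) (toℚᵘ-ι z) ⟨
  toℚᵘ (ι y) ℚᵘ.+ toℚᵘ (ι z)      ≈⟨ ℚ.toℚᵘ-homo-+ (ι y) (ι z) ⟨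
  toℚᵘ (ι y + ι z)                ∎)
  where open ℚᵘ.≃-Reasoning

ι-* : ∀ y z → ι (y ℤ.* z) ≡ ι y * ι z
ι-* y z = ℚ.toℚᵘ-injective (begin
  toℚᵘ (ι (y ℤ.* z))              ≈⟨ toℚᵘ-ι (y ℤ.* z) ⟩
  mkℚᵘ y 0 ℚᵘ.* mkℚᵘ z 0          ≈⟨ ℚᵘ.*-cong (toℚᵘ-ι y) (toℚᵘ-ι z) ⟨
  toℚᵘ (ι y) ℚᵘ.* toℚᵘ (ι z)      ≈⟨ ℚ.toℚᵘ-homo-* (ι y) (ι z) ⟨
  toℚᵘ (ι y * ι z)                ∎)
  where open ℚᵘ.≃-Reasoning

module _ {P : A → Set} (P? : U.Decidable P) where

  ∑-filter : ∀ xs (f : A → ℚ) → ∑ (filter P? xs) f ≡ ∑ xs (λ x → if does (P? x) then f x else 0ℚ)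
  ∑-filter []       f = refl
  ∑-filter (x ∷ xs) f with P? x
  ... | yes _ = cong (f x +_) (∑-filter xs f)
  ... | no  _ = trans (∑-filter xs f) (sym (ℚ.+-identityˡ _))

ι-sum : ∀ (xs : List A) (f : A → ℤ) → ι (sumℤ (map f xs)) ≡ ∑ xs (ι ∘ f)
ι-sum []       f = refl
ι-sum (x ∷ xs) f = trans (ι-+ (f x) _) (cong (ι (f x) +_) (ι-sum xs f))

ι-length : ∀ (xs : List A) → ι (ℤ.+ length xs) ≡ ∑ xs (λ _ → 1ℚ)
ι-length []       = refl
ι-length (x ∷ xs) = trans (ι-+ 1ℤ (ℤ.+ length xs)) (cong (1ℚ +_) (ι-length xs))

-- From the flag h-vector to the flag f-vector

∑-subsets : ∀ n (f : Subset (suc n) → ℚ) →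
            ∑ (subsets (suc n)) f ≡ ∑ (subsets n) (f ∘ (outside Vec.∷_)) + ∑ (subsets n) (f ∘ (inside Vec.∷_))
∑-subsets n f = trans (∑-++ (map (outside Vec.∷_) (subsets n)) _ f)
  (cong₂ _+_ (∑-map _ (subsets n) f) (∑-map _ (subsets n) f))

sign : ℕ → ℚ
sign k = ι (-1ℤ ℤ.^ k)

sign-suc : ∀ k → sign (suc k) ≡ - sign k
sign-suc k = trans (ι-* -1ℤ (-1ℤ ℤ.^ k)) (solve 1 (λ x → con (- 1ℚ) :* x := :- x) refl (sign k))

alternating : (Subset n → ℚ) → Subset n → ℚ
alternating {n} N S =
  ∑ (subsets n) (λ T → if does (T ⊆? S) then sign (∣ S ∣ ∸ ∣ T ∣) * N T else 0ℚ)

alternating-outside : ∀ (N : Subset (suc n) → ℚ) S →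
  alternating N (outside Vec.∷ S) ≡ alternating (N ∘ (outside Vec.∷_)) S
alternating-outside {n} N S = trans (∑-subsets n _)
  (trans (cong (alternating (N ∘ (outside Vec.∷_)) S +_) (∑-zero (subsets n) (λ _ → refl))) (ℚ.+-identityʳ _))

alternating-inside : ∀ (N : Subset (suc n) → ℚ) S →
  alternating N (inside Vec.∷ S) ≡
  - 1ℚ * alternating (N ∘ (outside Vec.∷_)) S + alternating (N ∘ (inside Vec.∷_)) S
alternating-inside {n} N S = trans (∑-subsets n _)
  (cong (_+ alternating (N ∘ (inside Vec.∷_)) S)
    (trans (∑-cong (subsets n) (λ T → negate T (T ⊆? S))) (∑-*ˡ (subsets n) (- 1ℚ) _)))
  where
  negate : ∀ T (T⊆?S : Dec (T ⊆ˢ S)) →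
    (if does T⊆?S then sign (suc ∣ S ∣ ∸ ∣ T ∣) * N (outside Vec.∷ T) else 0ℚ) ≡
    - 1ℚ * (if does T⊆?S then sign (∣ S ∣ ∸ ∣ T ∣) * N (outside Vec.∷ T) else 0ℚ)
  -- The inclusion of T in S makes the truncated subtraction exact, so the extra element of the
  -- larger set costs one sign.
  negate T (yes T⊆S) = trans
    (cong (_* N (outside Vec.∷ T)) (trans
      (cong sign (ℕ.+-∸-assoc 1 (p⊆q⇒∣p∣≤∣q∣ T⊆S))) (sign-suc (∣ S ∣ ∸ ∣ T ∣))))
    (solve 2 (λ x y → (:- x) :* y := con (- 1ℚ) :* (x :* y)) refl (sign (∣ S ∣ ∸ ∣ T ∣)) (N (outside Vec.∷ T)))
  negate T (no _)    = refl

stepᵃ-stepᵇ : ∀ m F i → stepᵃ m F i - stepᵇ m F i ≡ δ F i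
stepᵃ-stepᵇ m F i = split (i ℕ.+ i ℕ.≤? m)
  where
  split : ∀ (low? : Dec (i ℕ.+ i ℕ.≤ m)) →
    (if does low? then 0ℚ else δ F i) - (if does low? then - δ F i else 0ℚ) ≡ δ F i
  split (yes _) = solve 1 (λ x → con 0ℚ :- (:- x) := x) refl (δ F i)
  split (no  _) = solve 1 (λ x → x :- con 0ℚ := x) refl (δ F i)

-- The ab-index is the flag f-polynomial with a - b in place of a, and a - b acts as δ.
flagSeq : ℕ → Subset n → Seq → Seq
flagSeq m Vec.[]              = id
flagSeq m (outside Vec.∷ T)   = flagSeq (suc m) T ∘ δ
flagSeq m (inside  Vec.∷ T)   = flagSeq (suc m) T ∘ stepᵇ m

-- `flagSeq` consumes the lowest rank first, while the recurrence for chains adds a highest rank.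
-- This lemma and `flagSeq-inside` give access to the other end.
flagSeq-outside : ∀ m (T : Subset n) F → flagSeq m (T ∷ʳ outside) F ≡ δ (flagSeq m T F)
flagSeq-outside m Vec.[]              F = refl
flagSeq-outside m (outside Vec.∷ T)   F = flagSeq-outside (suc m) T (δ F)
flagSeq-outside m (inside  Vec.∷ T)   F = flagSeq-outside (suc m) T (stepᵇ m F)

flagSeq-inside : ∀ m (T : Subset n) F → flagSeq m (T ∷ʳ inside) F ≡ stepᵇ (m ℕ.+ n) (flagSeq m T F)
flagSeq-inside         m Vec.[]            F rewrite ℕ.+-identityʳ m = refl
flagSeq-inside {suc n} m (outside Vec.∷ T) F rewrite ℕ.+-suc m n = flagSeq-inside (suc m) T (δ F)
flagSeq-inside {suc n} m (inside  Vec.∷ T) F rewrite ℕ.+-suc m n = flagSeq-inside (suc m) T (stepᵇ m F)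

abLetters : Subset n → List AB
abLetters S = map (λ s → if s then b else a) (Vec.toList S)

-- The flag f-vector is replaced by an arbitrary N so that the induction can fix whether the lowest
-- rank is selected. With x and y the alternating sums of the two restrictions, the letters
-- contribute x on a and y - x on b, which regroups as x on a - b and y on b.
∑-alternating : ∀ m k (N : Subset n → ℚ) F →
  ∑ (subsets n) (λ S → alternating N S * shortWord m k (abLetters S) F) ≡
  ∑ (subsets n) (λ T → N T * short (m ℕ.+ n) k (flagSeq m T F))
∑-alternating {zero} m k N F rewrite ℕ.+-identityʳ m =
  solve 2 (λ x y → (con 1ℚ :* x :+ con 0ℚ) :* y :+ con 0ℚ := x :* y :+ con 0ℚ) refl (N Vec.[]) (short m k F)
∑-alternating {suc n} m k N F rewrite ℕ.+-suc m n = begin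
  ∑ (subsets (suc n)) (λ S → alternating N S * shortWord m k (abLetters S) F)
    ≡⟨ ∑-subsets n _ ⟩
  ∑ (subsets n) (λ S → alternating N (outside Vec.∷ S) * W S (stepᵃ m F)) +
  ∑ (subsets n) (λ S → alternating N (inside Vec.∷ S) * W S (stepᵇ m F))
    ≡⟨ sym (∑-+ (subsets n) _ _) ⟩
  ∑ (subsets n) (λ S → alternating N (outside Vec.∷ S) * W S (stepᵃ m F) +
                       alternating N (inside Vec.∷ S) * W S (stepᵇ m F))
    ≡⟨ ∑-cong (subsets n) regroup ⟩
  ∑ (subsets n) (λ S → alternating Nₒ S * W S (δ F) + alternating Nᵢ S * W S (stepᵇ m F))
    ≡⟨ ∑-+ (subsets n) _ _ ⟩
  ∑ (subsets n) (λ S → alternating Nₒ S * W S (δ F)) +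
  ∑ (subsets n) (λ S → alternating Nᵢ S * W S (stepᵇ m F))
    ≡⟨ cong₂ _+_ (∑-alternating (suc m) k Nₒ (δ F)) (∑-alternating (suc m) k Nᵢ (stepᵇ m F)) ⟩
  ∑ (subsets n) (λ T → Nₒ T * short (suc m ℕ.+ n) k (flagSeq (suc m) T (δ F))) +
  ∑ (subsets n) (λ T → Nᵢ T * short (suc m ℕ.+ n) k (flagSeq (suc m) T (stepᵇ m F)))
    ≡⟨ sym (∑-subsets n _) ⟩
  ∑ (subsets (suc n)) (λ T → N T * short (suc m ℕ.+ n) k (flagSeq m T F)) ∎
  where
  open ≡-Reasoning
  Nₒ Nᵢ : Subset n → ℚ
  Nₒ T = N (outside Vec.∷ T)
  Nᵢ T = N (inside Vec.∷ T)

  W : Subset n → Seq → ℚ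
  W S = shortWord (suc m) k (abLetters S)

  W-linear : ∀ S → Linear (W S)
  W-linear S = shortWord-linear (suc m) k (abLetters S)

  regroup : ∀ S → alternating N (outside Vec.∷ S) * W S (stepᵃ m F) +
                  alternating N (inside Vec.∷ S) * W S (stepᵇ m F) ≡
                  alternating Nₒ S * W S (δ F) + alternating Nᵢ S * W S (stepᵇ m F)
  regroup S = begin
    alternating N (outside Vec.∷ S) * W S (stepᵃ m F) + alternating N (inside Vec.∷ S) * W S (stepᵇ m F)
      ≡⟨ cong₂ (λ x y → x * W S (stepᵃ m F) + y * W S (stepᵇ m F))
           (alternating-outside N S) (alternating-inside N S) ⟩
    alternating Nₒ S * W S (stepᵃ m F) + (- 1ℚ * alternating Nₒ S + alternating Nᵢ S) * W S (stepᵇ m F)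
      ≡⟨ solve 4 (λ x y u v → x :* u :+ (con (- 1ℚ) :* x :+ y) :* v := x :* (u :- v) :+ y :* v) refl
           (alternating Nₒ S) (alternating Nᵢ S) (W S (stepᵃ m F)) (W S (stepᵇ m F)) ⟩
    alternating Nₒ S * (W S (stepᵃ m F) - W S (stepᵇ m F)) + alternating Nᵢ S * W S (stepᵇ m F)
      ≡⟨ cong (λ x → alternating Nₒ S * x + alternating Nᵢ S * W S (stepᵇ m F)) (trans
           (sym (L-minus (W-linear S) (stepᵃ m F) (stepᵇ m F))) (L-cong (W-linear S) (stepᵃ-stepᵇ m F))) ⟩
    alternating Nₒ S * W S (δ F) + alternating Nᵢ S * W S (stepᵇ m F) ∎

module _ (P : GradedPoset) where

  ι-flagH : ∀ (S : Subset n) → ι (flagH P S) ≡ alternating (λ T → ι (ℤ.+ flagF P T)) S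
  ι-flagH {n} S = trans (ι-sum (filter (_⊆? S) (subsets n)) _)
    (trans (∑-cong (filter (_⊆? S) (subsets n)) (λ T → ι-* (-1ℤ ℤ.^ (∣ S ∣ ∸ ∣ T ∣)) (ℤ.+ flagF P T)))
           (∑-filter (_⊆? S) (subsets n) _))

  eval-abIndex : ∀ n k F → eval (λ w → shortWord 0 k w F) (abIndex P n) ≡
    ∑ (subsets n) (λ T → ι (ℤ.+ flagF P T) * short n k (flagSeq 0 T F))
  eval-abIndex n k F = trans (∑-map _ (subsets n) _)
    (trans (∑-cong (subsets n) (λ S → cong (_* shortWord 0 k (abLetters S) F) (ι-flagH S)))
           (∑-alternating {n} 0 k (λ T → ι (ℤ.+ flagF P T)) F))

-- The recursion for the toric polynomials on coefficients

coeff-x-1-* : ∀ p → coeff (x-1 *ₚ p) ≗ δ (coeff p)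
coeff-x-1-* p zero = trans (coeff-+ ((- 1ℚ) ·ₚ p) _ 0) (trans
  (cong (_+ 0ℚ) (coeff-· (- 1ℚ) p 0)) (solve 1 (λ x → con (- 1ℚ) :* x :+ con 0ℚ := :- x) refl (coeff p 0)))
coeff-x-1-* p (suc i) = begin
  coeff (x-1 *ₚ p) (suc i)
    ≡⟨ coeff-+ ((- 1ℚ) ·ₚ p) (0ℚ ∷ ((1ℚ ·ₚ p) +ₚ [ 0ℚ ])) (suc i) ⟩
  coeff ((- 1ℚ) ·ₚ p) (suc i) + coeff ((1ℚ ·ₚ p) +ₚ [ 0ℚ ]) i
    ≡⟨ cong₂ _+_ (coeff-· (- 1ℚ) p (suc i))
         (trans (coeff-+ (1ℚ ·ₚ p) [ 0ℚ ] i) (cong₂ _+_ (coeff-· 1ℚ p i) (coeff-0 i))) ⟩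
  - 1ℚ * coeff p (suc i) + (1ℚ * coeff p i + 0ℚ)
    ≡⟨ solve 2 (λ x y → con (- 1ℚ) :* y :+ (con 1ℚ :* x :+ con 0ℚ) := x :- y) refl (coeff p i) (coeff p (suc i)) ⟩
  δ (coeff p) (suc i) ∎
  where
  open ≡-Reasoning
  coeff-0 : ∀ i → coeff [ 0ℚ ] i ≡ 0ℚ
  coeff-0 zero    = refl
  coeff-0 (suc i) = refl

-- Multiplication by p is built from scaling, adding and shifting, and `δ` commutes with all three.
coeff-*-x-1-* : ∀ p q → coeff (p *ₚ (x-1 *ₚ q)) ≗ δ (coeff (p *ₚ q))
coeff-*-x-1-* []      q zero    = refl
coeff-*-x-1-* []      q (suc i) = refl
coeff-*-x-1-* (r ∷ p) q i = begin
  coeff ((r ∷ p) *ₚ (x-1 *ₚ q)) i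
    ≡⟨ coeff-+ (r ·ₚ (x-1 *ₚ q)) _ i ⟩
  coeff (r ·ₚ (x-1 *ₚ q)) i + coeff (0ℚ ∷ p *ₚ (x-1 *ₚ q)) i
    ≡⟨ cong₂ _+_ (trans (coeff-· r (x-1 *ₚ q) i) (cong (r *_) (coeff-x-1-* q i))) (shift i) ⟩
  r * δ (coeff q) i + δ (coeff (0ℚ ∷ p *ₚ q)) i
    ≡⟨ sym (cong (_+ δ (coeff (0ℚ ∷ p *ₚ q)) i) (L-* (δ-linear i) r (coeff q))) ⟩
  δ (λ j → r * coeff q j) i + δ (coeff (0ℚ ∷ p *ₚ q)) i
    ≡⟨ sym (L-+ (δ-linear i) (λ j → r * coeff q j) (coeff (0ℚ ∷ p *ₚ q))) ⟩
  δ (λ j → r * coeff q j + coeff (0ℚ ∷ p *ₚ q) j) i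
    ≡⟨ L-cong (δ-linear i) (λ j → sym (trans (coeff-+ (r ·ₚ q) _ j)
         (cong (_+ coeff (0ℚ ∷ p *ₚ q) j) (coeff-· r q j)))) ⟩
  δ (coeff ((r ∷ p) *ₚ q)) i ∎
  where
  open ≡-Reasoning
  shift : ∀ i → coeff (0ℚ ∷ p *ₚ (x-1 *ₚ q)) i ≡ δ (coeff (0ℚ ∷ p *ₚ q)) i
  shift zero          = refl
  shift (suc zero)    = trans (coeff-*-x-1-* p q 0) (sym (ℚ.+-identityˡ _))
  shift (suc (suc i)) = coeff-*-x-1-* p q (suc i)

coeff-*-1 : ∀ p → coeff (p *ₚ 1ₚ) ≗ coeff p
coeff-*-1 []      i       = refl
coeff-*-1 (r ∷ p) zero    = solve 1 (λ r → r :* con 1ℚ :+ con 0ℚ := r) refl r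
coeff-*-1 (r ∷ p) (suc i) = coeff-*-1 p i

δ^ : ℕ → Seq → Seq
δ^ zero    F = F
δ^ (suc k) F = δ (δ^ k F)

coeff-*-x-1^ : ∀ p k → coeff (p *ₚ x-1 ^ₚ k) ≗ δ^ k (coeff p)
coeff-*-x-1^ p zero    = coeff-*-1 p
coeff-*-x-1^ p (suc k) i = trans (coeff-*-x-1-* p (x-1 ^ₚ k) i) (L-cong (δ-linear i) (coeff-*-x-1^ p k))

coeff-applyUpTo-< : ∀ f n {i} → i ℕ.< n → coeff (applyUpTo f n) i ≡ f i
coeff-applyUpTo-< f (suc n) {zero}  _         = refl
coeff-applyUpTo-< f (suc n) {suc i} (s≤s i<n) = coeff-applyUpTo-< (f ∘ suc) n i<n

coeff-applyUpTo-≥ : ∀ f n {i} → n ℕ.≤ i → coeff (applyUpTo f n) i ≡ 0ℚ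
coeff-applyUpTo-≥ f zero            _         = refl
coeff-applyUpTo-≥ f (suc n) {suc i} (s≤s n≤i) = coeff-applyUpTo-≥ (f ∘ suc) n n≤i

toricDifference-δ : ∀ p i → toricDifference p i ≡ - δ (coeff p) i
toricDifference-δ p zero    = solve 1 (λ x → x := :- (:- x)) refl (coeff p 0)
toricDifference-δ p (suc i) = solve 2 (λ x y → y :- x := :- (x :- y)) refl (coeff p i) (coeff p (suc i))

-- Successive differences of f are the coefficients of (1 - x) f, and the cutoff at half the degree
-- is i + i ≤ m. This is the origin of `stepᵇ`: up to truncation it is Stanley's passage from f to
-- g.
coeff-f→g : ∀ m p → coeff (f→g (suc m) p) ≗ stepᵇ m (coeff p)
coeff-f→g m p i with i ℕ.+ i ℕ.≤? m
... | yes low = trans (coeff-applyUpTo-< (toricDifference p) _ (s≤s (≤-half i m low)))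
                      (trans (toricDifference-δ p i) (sym (stepᵇ-low i low)))
... | no high = trans (coeff-applyUpTo-≥ (toricDifference p) _ (ℕ.≰⇒> (high ∘ half-≤ i m)))
                      (sym (stepᵇ-high i high))

-- Counting chains in rank-selected subposets

ind : Dec A → ℚ
ind A? = if does A? then 1ℚ else 0ℚ

ind-⇔ : (A? : Dec A) (B? : Dec B) → (A → B) → (B → A) → ind A? ≡ ind B?
ind-⇔ (yes p) B? to from = sym (if-yes B? (to p))
ind-⇔ (no ¬p) B? to from = sym (if-no B? (¬p ∘ from))

ind-× : (A? : Dec A) (B? : Dec B) → ind (A? ×-dec B?) ≡ (if does A? then ind B? else 0ℚ)
ind-× (yes _) B? = refl
ind-× (no _)  B? = refl

∑-ind-unique : ∀ {Q : Fin n → Set} (Q? : U.Decidable Q) (A? : Dec A) →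
               (A → ∃[ p ] Q p) → (∀ {p} → Q p → A) → (∀ {p q} → Q p → Q q → p ≡ q) →
               ∑ (allFin n) (ind ∘ Q?) ≡ ind A?
∑-ind-unique {n = n} Q? (yes p) to from unique with to p
... | x , Qx = trans (∑-single (allFin⁺ n) (∈-allFin x) (λ {y} _ y≢x → if-no (Q? y) (λ Qy → y≢x (unique Qy Qx))))
                     (if-yes (Q? x) Qx)
∑-ind-unique {n = n} Q? (no ¬p) to from unique = ∑-zero (allFin n) (λ {y} _ → if-no (Q? y) (¬p ∘ from))

∑-subsets-⊥ : ∀ n (f : Subset n → ℚ) → (∀ C x → x ∈ˢ C → f C ≡ 0ℚ) → ∑ (subsets n) f ≡ f ⊥
∑-subsets-⊥ zero    f f≡0 = ℚ.+-identityʳ _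
∑-subsets-⊥ (suc n) f f≡0 = trans (∑-subsets n f) (trans
  (cong₂ _+_ (∑-subsets-⊥ n (f ∘ (outside Vec.∷_)) (λ C x x∈C → f≡0 _ (Fin.suc x) (there x∈C)))
             (∑-zero (subsets n) (λ _ → f≡0 _ Fin.zero here)))
  (ℚ.+-identityʳ _))

-- Deleting p is a bijection from the sets containing p to those avoiding it, and f vanishes on the
-- former.
∑-subsets-remove : ∀ n (p : Fin n) (f : Subset n → ℚ) → (∀ C → p ∈ˢ C → f C ≡ 0ℚ) →
  ∑ (subsets n) (λ C → if does (p ∈? C) then f (C [ p ]≔ outside) else 0ℚ) ≡ ∑ (subsets n) f
∑-subsets-remove (suc n) Fin.zero f f≡0 = begin
  ∑ (subsets (suc n)) (λ C → if does (Fin.zero ∈? C) then f (C [ Fin.zero ]≔ outside) else 0ℚ)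
    ≡⟨ ∑-subsets n _ ⟩
  ∑ (subsets n) (λ _ → 0ℚ) + fₒ
    ≡⟨ ℚ.+-comm (∑ (subsets n) (λ _ → 0ℚ)) fₒ ⟩
  fₒ + ∑ (subsets n) (λ _ → 0ℚ)
    ≡⟨ cong (fₒ +_) (∑-cong (subsets n) (λ _ → sym (f≡0 _ here))) ⟩
  fₒ + ∑ (subsets n) (f ∘ (inside Vec.∷_))
    ≡⟨ sym (∑-subsets n f) ⟩
  ∑ (subsets (suc n)) f ∎
  where
  open ≡-Reasoning
  fₒ : ℚ
  fₒ = ∑ (subsets n) (f ∘ (outside Vec.∷_))
∑-subsets-remove (suc n) (Fin.suc p) f f≡0 = trans (∑-subsets n _) (trans
  (cong₂ _+_ (∑-subsets-remove n p (f ∘ (outside Vec.∷_)) (λ C p∈C → f≡0 _ (there p∈C)))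
             (∑-subsets-remove n p (f ∘ (inside Vec.∷_)) (λ C p∈C → f≡0 _ (there p∈C))))
  (sym (∑-subsets n f)))

∑-subsets-∷ʳ : ∀ n (f : Subset (suc n) → ℚ) →
  ∑ (subsets (suc n)) f ≡ ∑ (subsets n) (f ∘ (_∷ʳ outside)) + ∑ (subsets n) (f ∘ (_∷ʳ inside))
∑-subsets-∷ʳ zero    f = ∑-subsets zero f
∑-subsets-∷ʳ (suc n) f = begin
  ∑ (subsets (suc (suc n))) f
    ≡⟨ ∑-subsets (suc n) f ⟩
  ∑ (subsets (suc n)) (f ∘ (outside Vec.∷_)) + ∑ (subsets (suc n)) (f ∘ (inside Vec.∷_))
    ≡⟨ cong₂ _+_ (∑-subsets-∷ʳ n (f ∘ (outside Vec.∷_))) (∑-subsets-∷ʳ n (f ∘ (inside Vec.∷_))) ⟩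
  (f⟨ outside , outside ⟩ + f⟨ outside , inside ⟩) + (f⟨ inside , outside ⟩ + f⟨ inside , inside ⟩)
    ≡⟨ solve 4 (λ w x y z → (w :+ x) :+ (y :+ z) := (w :+ y) :+ (x :+ z)) refl
         f⟨ outside , outside ⟩ f⟨ outside , inside ⟩ f⟨ inside , outside ⟩ f⟨ inside , inside ⟩ ⟩
  (f⟨ outside , outside ⟩ + f⟨ inside , outside ⟩) + (f⟨ outside , inside ⟩ + f⟨ inside , inside ⟩)
    ≡⟨ sym (cong₂ _+_ (∑-subsets n (f ∘ (_∷ʳ outside))) (∑-subsets n (f ∘ (_∷ʳ inside)))) ⟩
  ∑ (subsets (suc n)) (f ∘ (_∷ʳ outside)) + ∑ (subsets (suc n)) (f ∘ (_∷ʳ inside)) ∎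
  where
  open ≡-Reasoning
  f⟨_,_⟩ : Side → Side → ℚ
  f⟨ s , t ⟩ = ∑ (subsets n) (λ T → f (s Vec.∷ (T ∷ʳ t)))

-- `RankSelected P T u` unfolds to `HasRank T (ρ u)`; abstracting the rank lets the facts about T be
-- stated without the poset.
HasRank : Subset n → ℕ → Set
HasRank T t = ∃[ i ] i ∈ˢ T × t ≡ suc (toℕ i)

HasRank-≤ : ∀ {T : Subset n} {t} → HasRank T t → t ℕ.≤ n
HasRank-≤ (i , _ , refl) = Fin.toℕ<n i

HasRank-∷ʳ⁺ : ∀ {T : Subset n} {s t} → HasRank T t → HasRank (T ∷ʳ s) t
HasRank-∷ʳ⁺ {s = s} (i , i∈T , eq) = inject₁ i , member i∈T , trans eq (cong suc (sym (Fin.toℕ-inject₁ i)))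
  where
  member : ∀ {n} {i : Fin n} {T} → i ∈ˢ T → inject₁ i ∈ˢ T ∷ʳ s
  member here        = here
  member (there i∈T) = there (member i∈T)

HasRank-last : ∀ (T : Subset n) → HasRank (T ∷ʳ inside) (suc n)
HasRank-last {n} T = fromℕ n , member T , cong suc (sym (Fin.toℕ-fromℕ n))
  where
  member : ∀ {n} (T : Subset n) → fromℕ n ∈ˢ T ∷ʳ inside
  member Vec.[]       = here
  member (s Vec.∷ T)  = there (member T)

HasRank-∷ʳ⁻ : ∀ (T : Subset n) {s t} → HasRank (T ∷ʳ s) t → HasRank T t ⊎ (s ≡ inside × t ≡ suc n)
HasRank-∷ʳ⁻ Vec.[]      (Fin.zero , here , eq) = inj₂ (refl , eq)
HasRank-∷ʳ⁻ (_ Vec.∷ T) (Fin.zero , here , eq) = inj₁ (Fin.zero , here , eq)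
HasRank-∷ʳ⁻ (_ Vec.∷ T) (Fin.suc i , there i∈T , refl) with HasRank-∷ʳ⁻ T (i , i∈T , refl)
... | inj₁ (j , j∈T , eq) = inj₁ (Fin.suc j , there j∈T , cong suc eq)
... | inj₂ (s≡in , eq)    = inj₂ (s≡in , cong suc eq)

-- As long as some element of K is not bounded by the current candidate, it becomes the next
-- candidate, and well-foundedness ends the search. Q is wider than K to admit a fallback such as
-- `0̂` or `1̂` when K is empty.
extremum : ∀ {m} {_⊏_ _⊑_ : Rel (Fin m) 0ℓ} → WellFounded _⊏_ → Decidable₂ _⊑_ →
  {K Q : Fin m → Set} → U.Decidable K → (∀ {u} → K u → Q u) →
  (∀ {x u} → Q x → K u → ¬ x ⊑ u → u ⊏ x) →
  ∀ {x} → Q x → ∃[ y ] Q y × (∀ u → K u → y ⊑ u)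
extremum {_⊏_ = _⊏_} {_⊑_} wf _⊑?_ {K} {Q} K? K⇒Q descend Qx = go (wf _) Qx
  where
  go : ∀ {x} → Acc _⊏_ x → Q x → ∃[ y ] Q y × (∀ u → K u → y ⊑ u)
  go {x} (acc rec) Qx with Fin.any? (λ u → K? u ×-dec ¬? (x ⊑? u))
  ... | yes (u , Ku , x⋢u) = go (rec (descend Qx Ku x⋢u)) (K⇒Q Ku)
  ... | no ∄u = x , Qx , λ u Ku → decidable-stable (x ⊑? u) (λ x⋢u → ∄u (u , Ku , x⋢u))

insert-∈⁻ : ∀ {m} (C : Subset m) z {u} → u ∈ˢ C [ z ]≔ inside → u ≡ z ⊎ u ∈ˢ C
insert-∈⁻ C z {u} u∈ with u Fin.≟ z
... | yes u≡z = inj₁ u≡z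
... | no  u≢z = inj₂ (Vec.lookup⇒[]= u C (trans (sym (Vec.lookup∘update′ u≢z C inside)) (Vec.[]=⇒lookup u∈)))

remove-∈⁻ : ∀ {m} (C : Subset m) p {u} → u ∈ˢ C [ p ]≔ outside → u ∈ˢ C × u ≢ p
remove-∈⁻ C p {u} u∈ with u Fin.≟ p
... | yes refl with () ← trans (sym (Vec.lookup∘update p C outside)) (Vec.[]=⇒lookup u∈)
... | no  u≢p = Vec.lookup⇒[]= u C (trans (sym (Vec.lookup∘update′ u≢p C outside)) (Vec.[]=⇒lookup u∈)) , u≢p

-- Ranks and full chains in a graded poset

module _ (P : GradedPoset) where
  open GradedPoset P
  private
    module ≤ = IsDecPartialOrder isDecPartialOrder
    module < = ToStrict _≡_ _≤_

    <-trans : ∀ {x y z} → x < y → y < z → x < z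
    <-trans = <.<-trans isPartialOrder

  <-cover : ∀ {x y} → x < y → ∃[ z ] z Covers x × z ≤ y
  <-cover {x} {y} = go (<-wellFounded y)
    where
    go : ∀ {y} → Acc _<_ y → x < y → ∃[ z ] z Covers x × z ≤ y
    go {y} (acc rec) x<y with Fin.any? (λ z → (x <? z) ×-dec (z <? y))
    ... | no ∄z = y , (x<y , ∄z) , ≤.refl
    ... | yes (z , x<z , z<y) with go (rec z<y) x<z
    ... | w , w⋗x , w≤z = w , w⋗x , ≤.trans w≤z (proj₁ z<y)

  >-wellFounded : WellFounded (flip _<_)
  >-wellFounded = po-noetherian isPartialOrder

  -- The rank axiom speaks of covers only, so the inequality is accumulated while climbing from x to
  -- y through successive covers.
  ρ-< : ∀ {x y} → x < y → ρ x ℕ.< ρ y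
  ρ-< {x} {y} = go (>-wellFounded x)
    where
    go : ∀ {x} → Acc (flip _<_) x → x < y → ρ x ℕ.< ρ y
    go {x} (acc rec) x<y with <-cover x<y
    ... | z , z⋗x , z≤y with z Fin.≟ y
    ... | yes refl = ℕ.≤-reflexive (sym (ρ-covers z⋗x))
    ... | no  z≢y  = ℕ.<-trans (ℕ.≤-reflexive (sym (ρ-covers z⋗x))) (go (rec (proj₁ z⋗x)) (z≤y , z≢y))

  ρ-≤ : ∀ {x y} → x ≤ y → ρ x ℕ.≤ ρ y
  ρ-≤ {x} {y} x≤y with x Fin.≟ y
  ... | yes refl = ℕ.≤-refl
  ... | no  x≢y  = ℕ.<⇒≤ (ρ-< (x≤y , x≢y))

  comparable-ρ-< : ∀ {x y} → x ≤ y ⊎ y ≤ x → ρ x ℕ.< ρ y → x < y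
  comparable-ρ-< (inj₁ x≤y) ρx<ρy = x≤y , λ x≡y → ℕ.<-irrefl (cong ρ x≡y) ρx<ρy
  comparable-ρ-< (inj₂ y≤x) ρx<ρy = contradiction (ρ-≤ y≤x) (ℕ.<⇒≱ ρx<ρy)

  comparable-ρ-≡ : ∀ {x y} → x ≤ y ⊎ y ≤ x → ρ x ≡ ρ y → x ≡ y
  comparable-ρ-≡ {x} {y} x∼y ρx≡ρy with x Fin.≟ y
  ... | yes x≡y = x≡y
  comparable-ρ-≡ (inj₁ x≤y) ρx≡ρy | no x≢y = contradiction (ρ-< (x≤y , x≢y)) (ℕ.<-irrefl ρx≡ρy)
  comparable-ρ-≡ (inj₂ y≤x) ρx≡ρy | no x≢y = contradiction (ρ-< (y≤x , x≢y ∘ sym)) (ℕ.<-irrefl (sym ρx≡ρy))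

  -- A discrete intermediate value argument: climbing from x by covers below y raises the rank by
  -- exactly one each time, so the value t cannot be skipped.
  between : ∀ {x y t} → x < y → ρ x ℕ.< t → t ℕ.< ρ y → ∃[ z ] x < z × z < y × ρ z ≡ t
  between {x} {y} {t} = go (>-wellFounded x)
    where
    go : ∀ {x} → Acc (flip _<_) x → x < y → ρ x ℕ.< t → t ℕ.< ρ y → ∃[ z ] x < z × z < y × ρ z ≡ t
    go {x} (acc rec) x<y ρx<t t<ρy with <-cover x<y
    ... | z , z⋗x , z≤y with ρ z ℕ.≟ t
    ... | yes refl = z , proj₁ z⋗x , comparable-ρ-< (inj₁ z≤y) t<ρy , refl
    ... | no  ρz≢t with go (rec (proj₁ z⋗x)) (comparable-ρ-< (inj₁ z≤y) (ℕ.<-trans ρz<t t<ρy)) ρz<t t<ρy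
      where
      ρz<t : ρ z ℕ.< t
      ρz<t = ℕ.≤∧≢⇒< (subst (ℕ._≤ t) (sym (ρ-covers z⋗x)) ρx<t) ρz≢t
    ... | w , z<w , w<y , eq = w , <-trans (proj₁ z⋗x) z<w , w<y , eq

  -- The maximal chains of [0̂,v) restricted to the ranks in T.
  record IsFullChain (v : Carrier) (T : Subset n) (C : Subset size) : Set where
    constructor fullChain
    field
      selected : ∀ u → u ∈ˢ C → RankSelected P T u × u < v
      chain    : ∀ u w → u ∈ˢ C → w ∈ˢ C → u ≤ w ⊎ w ≤ u
      full     : ∀ i → i ∈ˢ T → ∃[ u ] u ∈ˢ C × ρ u ≡ suc (toℕ i)

    full′ : ∀ {t} → HasRank T t → ∃[ u ] u ∈ˢ C × ρ u ≡ t
    full′ (i , i∈T , refl) = full i i∈T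

  open IsFullChain

  isFullChain? : ∀ v (T : Subset n) → U.Decidable (IsFullChain v T)
  isFullChain? v T C = map′ (λ (sel , ch , ful) → fullChain sel ch ful)
    (λ (fullChain sel ch ful) → sel , ch , ful)
    (Fin.all? (λ u → (u ∈? C) →-dec (rankSelected? P T u ×-dec (u <? v)))
     ×-dec Fin.all? (λ u → Fin.all? λ w → (u ∈? C) →-dec ((w ∈? C) →-dec ((u ≤? w) ⊎-dec (w ≤? u))))
     ×-dec Fin.all? (λ i → (i ∈? T) →-dec Fin.any? (λ u → (u ∈? C) ×-dec (ρ u ℕ.≟ suc (toℕ i)))))

  -- An element added to C would share its rank with a member of C, and comparable elements of equal
  -- rank coincide.
  fullChain-maximal : ∀ {v} {T : Subset n} {C} → IsFullChain v T C → IsMaximalChain P T C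
  fullChain-maximal {T = T} fc = ((λ u u∈C → proj₁ (selected fc u u∈C)) , chain fc) ,
    λ (D , (selD , chainD) , C⊆D , x , x∈D , x∉C) →
      let (u , u∈C , ρu≡ρx) = full′ fc (selD x x∈D)
      in x∉C (subst (_∈ˢ _) (comparable-ρ-≡ (chainD u x (C⊆D u∈C) x∈D) ρu≡ρx) u∈C)

  module _ (rank≡1+n : rank ≡ suc n) {T : Subset n} {C : Subset size} where

    private
      HasRank-< : ∀ {t} → HasRank T t → t ℕ.< ρ 1̂
      HasRank-< t∈T = subst (_ ℕ.<_) (sym rank≡1+n) (s≤s (HasRank-≤ t∈T))

    -- Take the greatest member x of C of rank below t, or `0̂`, and the least member y of rank
    -- above t, or `1̂`. Any z of rank t between them is comparable with all of C. The fallback `1̂`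
    -- is admissible because its rank n + 1 exceeds every rank in T.
    refine : IsChain P T C → ∀ {t} → HasRank T t → ¬ (∃[ u ] u ∈ˢ C × ρ u ≡ t) →
             ∃[ D ] IsChain P T D × C ⊂ D
    refine (sel , ch) {t} t∈T@(i , _ , t≡1+i) missing
      with extremum {_⊑_ = flip _≤_} >-wellFounded (flip _≤?_) {Q = λ u → (u ∈ˢ C ⊎ u ≡ 0̂) × ρ u ℕ.< t}
             (λ u → (u ∈? C) ×-dec (ρ u ℕ.<? t))
             (λ (u∈C , ρu<t) → inj₁ u∈C , ρu<t)
             (λ { (inj₁ x∈C , _) (u∈C , _) u≰x → comparable-strict (ch _ _ x∈C u∈C) u≰x
                ; (inj₂ refl , _) _ u≰0̂ → comparable-strict (inj₁ (minimum _)) u≰0̂ })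
             (inj₂ refl , subst₂ ℕ._<_ (sym ρ-0̂) (sym t≡1+i) (s≤s z≤n))
         | extremum {_⊑_ = _≤_} <-wellFounded _≤?_ {Q = λ u → (u ∈ˢ C ⊎ u ≡ 1̂) × t ℕ.< ρ u}
             (λ u → (u ∈? C) ×-dec (t ℕ.<? ρ u))
             (λ (u∈C , t<ρu) → inj₁ u∈C , t<ρu)
             (λ { (inj₁ x∈C , _) (u∈C , _) x≰u → comparable-strict (ch _ _ u∈C x∈C) x≰u
                ; (inj₂ refl , _) _ 1̂≰u → comparable-strict (inj₁ (maximum _)) 1̂≰u })
             (inj₂ refl , HasRank-< t∈T)
      where
      comparable-strict : ∀ {x u} → x ≤ u ⊎ u ≤ x → ¬ u ≤ x → x < u
      comparable-strict (inj₁ x≤u) u≰x = x≤u , λ x≡u → u≰x (≤.reflexive (sym x≡u))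
      comparable-strict (inj₂ u≤x) u≰x = contradiction u≤x u≰x
    ... | x , (x∈ , ρx<t) , x-max | y , (y∈ , t<ρy) , y-min
      with between (comparable-ρ-< (comparable x∈ y∈) (ℕ.<-trans ρx<t t<ρy)) ρx<t t<ρy
      where
      comparable : ∀ {x y} → x ∈ˢ C ⊎ x ≡ 0̂ → y ∈ˢ C ⊎ y ≡ 1̂ → x ≤ y ⊎ y ≤ x
      comparable (inj₁ x∈C)  (inj₁ y∈C)  = ch _ _ x∈C y∈C
      comparable (inj₁ _)    (inj₂ refl) = inj₁ (maximum _)
      comparable (inj₂ refl) _           = inj₁ (minimum _)
    ... | z , x<z , z<y , refl = C [ z ]≔ inside , (selD , chD) , C⊆D , z , Vec.[]≔-updates C z , z∉C
      where
      z∉C : z ∉ˢ C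
      z∉C z∈C = missing (z , z∈C , refl)

      z-comparable : ∀ u → u ∈ˢ C → u ≤ z ⊎ z ≤ u
      z-comparable u u∈C with ℕ.<-cmp (ρ u) (ρ z)
      ... | tri< ρu<t _ _ = inj₁ (≤.trans (x-max u (u∈C , ρu<t)) (proj₁ x<z))
      ... | tri≈ _ ρu≡t _ = contradiction (u , u∈C , ρu≡t) missing
      ... | tri> _ _ t<ρu = inj₂ (≤.trans (proj₁ z<y) (y-min u (u∈C , t<ρu)))

      C⊆D : ∀ {u} → u ∈ˢ C → u ∈ˢ C [ z ]≔ inside
      C⊆D {u} u∈C = Vec.[]≔-minimal C u z (λ { refl → z∉C u∈C }) u∈C

      selD : ∀ u → u ∈ˢ C [ z ]≔ inside → RankSelected P T u
      selD u u∈D with insert-∈⁻ C z u∈D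
      ... | inj₁ refl = t∈T
      ... | inj₂ u∈C  = sel u u∈C

      chD : ∀ u w → u ∈ˢ C [ z ]≔ inside → w ∈ˢ C [ z ]≔ inside → u ≤ w ⊎ w ≤ u
      chD u w u∈D w∈D with insert-∈⁻ C z u∈D | insert-∈⁻ C z w∈D
      ... | inj₁ refl | inj₁ refl = inj₁ ≤.refl
      ... | inj₁ refl | inj₂ w∈C  = Sum.swap (z-comparable w w∈C)
      ... | inj₂ u∈C  | inj₁ refl = z-comparable u u∈C
      ... | inj₂ u∈C  | inj₂ w∈C  = ch u w u∈C w∈C

    maximal-fullChain : IsMaximalChain P T C → IsFullChain 1̂ T C
    maximal-fullChain (isChain , maximal) = fullChain
      (λ u u∈C → let t∈T = proj₁ isChain u u∈C in
         t∈T , comparable-ρ-< (inj₁ (maximum u)) (HasRank-< t∈T))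
      (proj₂ isChain)
      (λ i i∈T → decidable-stable (Fin.any? (λ u → (u ∈? C) ×-dec (ρ u ℕ.≟ suc (toℕ i))))
         (λ missing → maximal (refine isChain (i , i∈T , refl) missing)))

  fullChains : Carrier → Subset n → ℚ
  fullChains v T = ∑ (subsets size) (λ C → ind (isFullChain? v T C))

  flagF-fullChains : rank ≡ suc n → ∀ (T : Subset n) → ι (ℤ.+ flagF P T) ≡ fullChains 1̂ T
  flagF-fullChains rank≡1+n T = trans (ι-length (filter (isMaximalChain? P T) (subsets size)))
    (trans (∑-filter (isMaximalChain? P T) (subsets size) (λ _ → 1ℚ))
      (∑-cong (subsets size) (λ C → ind-⇔ (isMaximalChain? P T C) (isFullChain? 1̂ T C)
        (maximal-fullChain rank≡1+n) fullChain-maximal)))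

  fullChains-[] : ∀ v → fullChains v Vec.[] ≡ 1ℚ
  fullChains-[] v = trans
    (∑-subsets-⊥ size _ (λ C x x∈C → if-no (isFullChain? v Vec.[] C) (λ fc → nonempty (proj₁ (selected fc x x∈C)))))
    (if-yes (isFullChain? v Vec.[] ⊥) (fullChain
      (λ u u∈⊥ → contradiction u∈⊥ ∉⊥) (λ u w u∈⊥ → contradiction u∈⊥ ∉⊥) (λ ())))
    where
    nonempty : ∀ {t} → ¬ HasRank Vec.[] t
    nonempty (() , _)

  fullChains-outside : ∀ v (T : Subset n) → fullChains v (T ∷ʳ outside) ≡ fullChains v T
  fullChains-outside v T = ∑-cong (subsets size) (λ C →
    ind-⇔ (isFullChain? v (T ∷ʳ outside) C) (isFullChain? v T C)
      (λ fc → fullChain (λ u u∈C → restrict (proj₁ (selected fc u u∈C)) , proj₂ (selected fc u u∈C))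
                (chain fc) (λ i i∈T → full′ fc (HasRank-∷ʳ⁺ (i , i∈T , refl))))
      (λ fc → fullChain (λ u u∈C → HasRank-∷ʳ⁺ (proj₁ (selected fc u u∈C)) , proj₂ (selected fc u u∈C))
                (chain fc) (λ i i∈T → full′ fc (restrict (i , i∈T , refl)))))
    where
    restrict : ∀ {t} → HasRank (T ∷ʳ outside) t → HasRank T t
    restrict t∈ with HasRank-∷ʳ⁻ T t∈
    ... | inj₁ t∈T = t∈T

  -- A full chain of T ∷ʳ inside is an element p of rank n + 1 on top of a full chain of T below p.
  fullChains-inside : ∀ v (T : Subset n) → fullChains v (T ∷ʳ inside) ≡
    ∑ (allFin size) (λ p → ind ((p <? v) ×-dec (ρ p ℕ.≟ suc n)) * fullChains p T)
  fullChains-inside {n} v T = begin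
    ∑ (subsets size) (λ C → ind (isFullChain? v (T ∷ʳ inside) C))
      ≡⟨ ∑-cong (subsets size) (λ C → sym (∑-ind-unique (top? C) (isFullChain? v (T ∷ʳ inside) C)
           detach attach unique)) ⟩
    ∑ (subsets size) (λ C → ∑ (allFin size) (λ p → ind (top? C p)))
      ≡⟨ ∑-swap (subsets size) (allFin size) (λ C p → ind (top? C p)) ⟩
    ∑ (allFin size) (λ p → ∑ (subsets size) (λ C → ind (top? C p)))
      ≡⟨ ∑-cong (allFin size) (λ p → ∑-cong (subsets size) (λ C → split p C)) ⟩
    ∑ (allFin size) (λ p → ∑ (subsets size) (λ C →
      if does (p ∈? C) then ind (top-rank? p) * ind (isFullChain? p T (C [ p ]≔ outside)) else 0ℚ))
      -- A full chain below p cannot contain p, so summing over chains with p deleted counts all of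
      -- them once.
      ≡⟨ ∑-cong (allFin size) (λ p → ∑-subsets-remove size p
           (λ C → ind (top-rank? p) * ind (isFullChain? p T C)) (λ C p∈C →
             trans (cong (ind (top-rank? p) *_) (if-no (isFullChain? p T C) (λ fc → proj₂ (proj₂ (selected fc p p∈C)) refl)))
                   (ℚ.*-zeroʳ (ind (top-rank? p))))) ⟩
    ∑ (allFin size) (λ p → ∑ (subsets size) (λ C → ind (top-rank? p) * ind (isFullChain? p T C)))
      ≡⟨ ∑-cong (allFin size) (λ p → ∑-*ˡ (subsets size) (ind (top-rank? p)) _) ⟩
    ∑ (allFin size) (λ p → ind (top-rank? p) * fullChains p T) ∎
    where
    open ≡-Reasoning

    top-rank? : ∀ p → Dec (p < v × ρ p ≡ suc n)
    top-rank? p = (p <? v) ×-dec (ρ p ℕ.≟ suc n)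

    Top : Subset size → Carrier → Set
    Top C p = p ∈ˢ C × (p < v × ρ p ≡ suc n) × IsFullChain p T (C [ p ]≔ outside)

    top? : ∀ C → U.Decidable (Top C)
    top? C p = (p ∈? C) ×-dec (top-rank? p ×-dec isFullChain? p T (C [ p ]≔ outside))

    ind-* : (A? : Dec A) (B? : Dec B) → ind (A? ×-dec B?) ≡ ind A? * ind B?
    ind-* (yes _) B? = sym (ℚ.*-identityˡ (ind B?))
    ind-* (no _)  B? = sym (ℚ.*-zeroˡ (ind B?))

    split : ∀ p C → ind (top? C p) ≡
      (if does (p ∈? C) then ind (top-rank? p) * ind (isFullChain? p T (C [ p ]≔ outside)) else 0ℚ)
    split p C = trans (ind-× (p ∈? C) (top-rank? p ×-dec isFullChain? p T (C [ p ]≔ outside)))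
      (cong (λ x → if does (p ∈? C) then x else 0ℚ) (ind-* (top-rank? p) (isFullChain? p T (C [ p ]≔ outside))))

    ¬HasRank-1+n : ¬ HasRank T (suc n)
    ¬HasRank-1+n t∈T = ℕ.<-irrefl refl (HasRank-≤ t∈T)

    keep : ∀ {C p u} → u ∈ˢ C → u ≢ p → u ∈ˢ C [ p ]≔ outside
    keep {C} {p} {u} u∈C u≢p = Vec.[]≔-minimal C u p u≢p u∈C

    unique : ∀ {C p q} → Top C p → Top C q → p ≡ q
    unique {C} {p} {q} (_ , _ , fc) (q∈C , (_ , ρq≡1+n) , _) with p Fin.≟ q
    ... | yes p≡q = p≡q
    ... | no  p≢q = contradiction
      (subst (HasRank T) ρq≡1+n (proj₁ (selected fc q (keep q∈C (p≢q ∘ sym))))) ¬HasRank-1+n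

    detach : ∀ {C} → IsFullChain v (T ∷ʳ inside) C → ∃[ p ] Top C p
    detach {C} fc with full′ fc (HasRank-last T)
    ... | p , p∈C , ρp≡1+n = p , p∈C , (proj₂ (selected fc p p∈C) , ρp≡1+n) , fullChain sel
      (λ u w u∈ w∈ → chain fc u w (proj₁ (remove-∈⁻ C p u∈)) (proj₁ (remove-∈⁻ C p w∈)))
      (λ i i∈T → let t∈T = (i , i∈T , refl)
                     (u , u∈C , ρu≡t) = full′ fc (HasRank-∷ʳ⁺ t∈T)
                 in u , keep u∈C (λ { refl → ¬HasRank-1+n (subst (HasRank T) (trans (sym ρu≡t) ρp≡1+n) t∈T) }) , ρu≡t)
      where
      sel : ∀ u → u ∈ˢ C [ p ]≔ outside → RankSelected P T u × u < p
      sel u u∈ with remove-∈⁻ C p u∈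
      ... | u∈C , u≢p with HasRank-∷ʳ⁻ T (proj₁ (selected fc u u∈C))
      ... | inj₁ ρu∈T = ρu∈T , comparable-ρ-< (chain fc u p u∈C p∈C)
                          (subst (ρ u ℕ.<_) (sym ρp≡1+n) (s≤s (HasRank-≤ ρu∈T)))
      ... | inj₂ (_ , ρu≡1+n) = contradiction
                          (comparable-ρ-≡ (chain fc u p u∈C p∈C) (trans ρu≡1+n (sym ρp≡1+n))) u≢p

    attach : ∀ {C p} → Top C p → IsFullChain v (T ∷ʳ inside) C
    attach {C} {p} (p∈C , (p<v , ρp≡1+n) , fc) = fullChain sel ch ful
      where
      sel : ∀ u → u ∈ˢ C → RankSelected P (T ∷ʳ inside) u × u < v
      sel u u∈C with u Fin.≟ p
      ... | yes refl = subst (HasRank (T ∷ʳ inside)) (sym ρp≡1+n) (HasRank-last T) , p<v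
      ... | no  u≢p  = let (ρu∈T , u<p) = selected fc u (keep u∈C u≢p) in
                       HasRank-∷ʳ⁺ ρu∈T , <-trans u<p p<v

      ch : ∀ u w → u ∈ˢ C → w ∈ˢ C → u ≤ w ⊎ w ≤ u
      ch u w u∈C w∈C with u Fin.≟ p | w Fin.≟ p
      ... | yes refl | yes refl = inj₁ ≤.refl
      ... | yes refl | no  w≢p  = inj₂ (proj₁ (proj₂ (selected fc w (keep w∈C w≢p))))
      ... | no  u≢p  | yes refl = inj₁ (proj₁ (proj₂ (selected fc u (keep u∈C u≢p))))
      ... | no  u≢p  | no  w≢p  = chain fc u w (keep u∈C u≢p) (keep w∈C w≢p)

      ful : ∀ i → i ∈ˢ T ∷ʳ inside → ∃[ u ] u ∈ˢ C × ρ u ≡ suc (toℕ i)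
      ful i i∈ with HasRank-∷ʳ⁻ T (i , i∈ , refl)
      ... | inj₂ (_ , t≡1+n) = p , p∈C , trans ρp≡1+n (sym t≡1+n)
      ... | inj₁ t∈T = let (u , u∈ , ρu≡t) = full′ fc t∈T in u , proj₁ (remove-∈⁻ C p u∈) , ρu≡t

-- Toric polynomials from full chains

module _ (P : GradedPoset) where
  open GradedPoset P

  -- For v of rank n + 1 this is f([0̂,v),x), computed from the flag f-vector of [0̂,v].
  flagToric : Carrier → ℕ → Seq
  flagToric v n i = ∑ (subsets n) (λ T → fullChains P v T * flagSeq 0 T (coeff 1ₚ) i)

  below? : ∀ n v p → Dec (p < v × ρ p ℕ.≤ n)
  below? n v p = (p <? v) ×-dec (ρ p ℕ.≤? n)

  atop? : ∀ n v p → Dec (p < v × ρ p ≡ suc n)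
  atop? n v p = (p <? v) ×-dec (ρ p ℕ.≟ suc n)

  -- Stanley's sum for [0̂,v), restricted to ranks at most n and with exponents measured from n.
  -- Separating n from the rank of v allows induction on n with v fixed.
  partialToric : Carrier → ℕ → Seq
  partialToric v n i =
    ∑ (allFin size) (λ p → ind (below? n v p) * δ^ (n ∸ ρ p) (coeff (toricG P p)) i)

  toricF-partialToric : ∀ {v n} → ρ v ≡ suc n → coeff (toricF P v) ≗ partialToric v n
  toricF-partialToric {v} {n} ρv≡1+n i = begin
    coeff (toricF P v) i
      ≡⟨ cong (λ p → coeff p i) (toricF-suc P v n ρv≡1+n) ⟩
    coeff (sumₚ (map gTerm (filter (_<? v) (allFin size)))) i
      ≡⟨ coeff-sum (filter (_<? v) (allFin size)) gTerm i ⟩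
    ∑ (filter (_<? v) (allFin size)) (λ p → coeff (gTerm p) i)
      ≡⟨ ∑-filter (_<? v) (allFin size) (λ p → coeff (gTerm p) i) ⟩
    ∑ (allFin size) (λ p → if does (p <? v) then coeff (gTerm p) i else 0ℚ)
      ≡⟨ ∑-cong (allFin size) (λ p → term p (p <? v)) ⟩
    partialToric v n i ∎
    where
    open ≡-Reasoning
    gTerm : Carrier → Poly
    gTerm p = toricG P p *ₚ x-1 ^ₚ (n ∸ ρ p)

    term : ∀ p (p<?v : Dec (p < v)) → (if does p<?v then coeff (gTerm p) i else 0ℚ) ≡
           ind (p<?v ×-dec (ρ p ℕ.≤? n)) * δ^ (n ∸ ρ p) (coeff (toricG P p)) i
    term p (no _)    = sym (ℚ.*-zeroˡ (δ^ (n ∸ ρ p) (coeff (toricG P p)) i))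
    -- Below an element of rank n + 1 the cutoff ρ p ≤ n holds automatically.
    term p (yes p<v) = trans (coeff-*-x-1^ (toricG P p) (n ∸ ρ p) i) (trans (sym (ℚ.*-identityˡ _))
      (cong (_* δ^ (n ∸ ρ p) (coeff (toricG P p)) i)
            (sym (if-yes (ρ p ℕ.≤? n) (ℕ.≤-pred (subst (ρ p ℕ.<_) ρv≡1+n (ρ-< P p<v)))))))

  toricG-suc : ∀ {v n} → ρ v ≡ suc n → coeff (toricG P v) ≗ stepᵇ n (coeff (toricF P v))
  toricG-suc {v} {n} ρv≡1+n i =
    trans (cong (λ r → coeff (f→g r (toricF P v)) i) ρv≡1+n) (coeff-f→g n (toricF P v) i)

  partialToric-zero : ∀ {v} → 0 ℕ.< ρ v → partialToric v 0 ≗ coeff 1ₚ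
  partialToric-zero {v} 0<ρv i = trans (∑-single (allFin⁺ size) (∈-allFin 0̂) other) (begin
    ind (below? 0 v 0̂) * δ^ (0 ∸ ρ 0̂) (coeff (toricG P 0̂)) i
      ≡⟨ cong₂ _*_ (if-yes (below? 0 v 0̂) (0̂<v , ℕ.≤-reflexive ρ-0̂))
           (cong₂ (λ k q → δ^ k (coeff q) i) (ℕ.0∸n≡0 (ρ 0̂)) (cong (λ r → f→g r (toricF P 0̂)) ρ-0̂)) ⟩
    1ℚ * coeff 1ₚ i
      ≡⟨ ℚ.*-identityˡ (coeff 1ₚ i) ⟩
    coeff 1ₚ i ∎)
    where
    open ≡-Reasoning
    0̂<v : 0̂ < v
    0̂<v = comparable-ρ-< P (inj₁ (minimum v)) (subst (ℕ._< ρ v) (sym ρ-0̂) 0<ρv)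

    other : ∀ {p} → _ → p ≢ 0̂ → ind (below? 0 v p) * δ^ (0 ∸ ρ p) (coeff (toricG P p)) i ≡ 0ℚ
    other {p} _ p≢0̂ = trans
      (cong (_* δ^ (0 ∸ ρ p) (coeff (toricG P p)) i) (if-no (below? 0 v p) λ (_ , ρp≤0) →
        ℕ.<⇒≱ (ρ-< P (minimum p , p≢0̂ ∘ sym)) (ℕ.≤-trans ρp≤0 z≤n)))
      (ℚ.*-zeroˡ (δ^ (0 ∸ ρ p) (coeff (toricG P p)) i))

  -- Horner's scheme in x - 1: raising the cutoff multiplies every old term by x - 1, and the
  -- elements of rank n + 1 enter with exponent zero.
  partialToric-suc : ∀ v n i → partialToric v (suc n) i ≡
    δ (partialToric v n) i + ∑ (allFin size) (λ p → ind (atop? n v p) * coeff (toricG P p) i)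
  partialToric-suc v n i = begin
    partialToric v (suc n) i
      ≡⟨ ∑-cong (allFin size) (λ p → term p (p <? v)) ⟩
    ∑ (allFin size) (λ p → ind (below? n v p) * δ (δ^ (n ∸ ρ p) (coeff (toricG P p))) i +
                           ind (atop? n v p) * coeff (toricG P p) i)
      ≡⟨ ∑-+ (allFin size) _ _ ⟩
    ∑ (allFin size) (λ p → ind (below? n v p) * δ (δ^ (n ∸ ρ p) (coeff (toricG P p))) i) +
    ∑ (allFin size) (λ p → ind (atop? n v p) * coeff (toricG P p) i)
      ≡⟨ cong (_+ ∑ (allFin size) (λ p → ind (atop? n v p) * coeff (toricG P p) i))
           (sym (L-∑ (δ-linear i) (allFin size) (λ p → ind (below? n v p))
                  (λ p → δ^ (n ∸ ρ p) (coeff (toricG P p))))) ⟩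
    δ (partialToric v n) i + ∑ (allFin size) (λ p → ind (atop? n v p) * coeff (toricG P p) i) ∎
    where
    open ≡-Reasoning

    zeros : ∀ x y z → 0ℚ * x ≡ 0ℚ * y + 0ℚ * z
    zeros = solve 3 (λ x y z → con 0ℚ :* x := con 0ℚ :* y :+ con 0ℚ :* z) refl

    term : ∀ p (p<?v : Dec (p < v)) →
      ind (p<?v ×-dec (ρ p ℕ.≤? suc n)) * δ^ (suc n ∸ ρ p) (coeff (toricG P p)) i ≡
      ind (p<?v ×-dec (ρ p ℕ.≤? n)) * δ (δ^ (n ∸ ρ p) (coeff (toricG P p))) i +
      ind (p<?v ×-dec (ρ p ℕ.≟ suc n)) * coeff (toricG P p) i
    term p (no _)  = zeros (δ^ (suc n ∸ ρ p) (coeff (toricG P p)) i)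
      (δ (δ^ (n ∸ ρ p) (coeff (toricG P p))) i) (coeff (toricG P p) i)
    term p (yes _) = combine (ρ p) (coeff (toricG P p)) (ρ p ℕ.≤? n) (ρ p ℕ.≤? suc n) (ρ p ℕ.≟ suc n)
      where
      combine : ∀ r F (≤n? : Dec (r ℕ.≤ n)) (≤1+n? : Dec (r ℕ.≤ suc n)) (≡1+n? : Dec (r ≡ suc n)) →
        ind ≤1+n? * δ^ (suc n ∸ r) F i ≡ ind ≤n? * δ (δ^ (n ∸ r) F) i + ind ≡1+n? * F i
      -- Only the first three patterns are consistent: r ≤ n, r = n + 1 and r > n + 1.
      combine r F (yes r≤n) (yes _) (no _) rewrite ℕ.+-∸-assoc 1 r≤n =
        solve 2 (λ x y → con 1ℚ :* x := con 1ℚ :* x :+ con 0ℚ :* y) refl (δ (δ^ (n ∸ r) F) i) (F i)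
      combine _ F (no _) (yes _) (yes refl) rewrite ℕ.n∸n≡0 n =
        solve 2 (λ x y → con 1ℚ :* y := con 0ℚ :* x :+ con 1ℚ :* y) refl (δ (δ^ (n ∸ suc n) F) i) (F i)
      combine r F (no _) (no _) (no _) = zeros (δ^ (suc n ∸ r) F i) (δ (δ^ (n ∸ r) F) i) (F i)
      combine _ F (yes 1+n≤n) _ (yes refl) = contradiction 1+n≤n ℕ.1+n≰n
      combine _ F (yes r≤n) (no r≰1+n) (no _) = contradiction (ℕ.m≤n⇒m≤1+n r≤n) r≰1+n
      combine _ F (no r≰n) (yes r≤1+n) (no r≢1+n) = contradiction (ℕ.≤-pred (ℕ.≤∧≢⇒< r≤1+n r≢1+n)) r≰n
      combine _ F (no _) (no r≰1+n) (yes refl) = contradiction ℕ.≤-refl r≰1+n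

  -- Rank sets are split by their highest possible rank n + 1. If it is absent, the last factor is
  -- `δ`; if it is present, the top element p of the chain is split off and the remainder is a chain
  -- below p.
  flagToric-suc : ∀ v n i → flagToric v (suc n) i ≡
    δ (flagToric v n) i + ∑ (allFin size) (λ p → ind (atop? n v p) * stepᵇ n (flagToric p n) i)
  flagToric-suc v n i = begin
    flagToric v (suc n) i
      ≡⟨ ∑-subsets-∷ʳ n _ ⟩
    ∑ (subsets n) (λ T → fullChains P v (T ∷ʳ outside) * flagSeq 0 (T ∷ʳ outside) (coeff 1ₚ) i) +
    ∑ (subsets n) (λ T → fullChains P v (T ∷ʳ inside) * flagSeq 0 (T ∷ʳ inside) (coeff 1ₚ) i)
      ≡⟨ cong₂ _+_
           (∑-cong (subsets n) λ T → cong₂ (λ x F → x * F i)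
             (fullChains-outside P v T) (flagSeq-outside 0 T (coeff 1ₚ)))
           (∑-cong (subsets n) λ T → cong₂ (λ x F → x * F i)
             (fullChains-inside P v T) (flagSeq-inside 0 T (coeff 1ₚ))) ⟩
    ∑ (subsets n) (λ T → fullChains P v T * δ (F T) i) +
    ∑ (subsets n) (λ T → ∑ (allFin size) (λ p → ind (atop? n v p) * fullChains P p T) * stepᵇ n (F T) i)
      ≡⟨ cong₂ _+_ (sym (L-∑ (δ-linear i) (subsets n) (fullChains P v) F)) peel ⟩
    δ (flagToric v n) i + ∑ (allFin size) (λ p → ind (atop? n v p) * stepᵇ n (flagToric p n) i) ∎
    where
    open ≡-Reasoning
    F : Subset n → Seq
    F T = flagSeq 0 T (coeff 1ₚ)

    peel : ∑ (subsets n) (λ T → ∑ (allFin size) (λ p → ind (atop? n v p) * fullChains P p T) * stepᵇ n (F T) i) ≡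
           ∑ (allFin size) (λ p → ind (atop? n v p) * stepᵇ n (flagToric p n) i)
    peel = begin
      ∑ (subsets n) (λ T → ∑ (allFin size) (λ p → ind (atop? n v p) * fullChains P p T) * stepᵇ n (F T) i)
        ≡⟨ ∑-cong (subsets n) (λ T → sym (∑-*ʳ (allFin size) (stepᵇ n (F T) i) _)) ⟩
      ∑ (subsets n) (λ T → ∑ (allFin size) (λ p → ind (atop? n v p) * fullChains P p T * stepᵇ n (F T) i))
        ≡⟨ ∑-swap (subsets n) (allFin size) (λ T p → ind (atop? n v p) * fullChains P p T * stepᵇ n (F T) i) ⟩
      ∑ (allFin size) (λ p → ∑ (subsets n) (λ T → ind (atop? n v p) * fullChains P p T * stepᵇ n (F T) i))
        ≡⟨ ∑-cong (allFin size) (λ p → trans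
             (∑-cong (subsets n) (λ T → ℚ.*-assoc (ind (atop? n v p)) (fullChains P p T) (stepᵇ n (F T) i)))
             (trans (∑-*ˡ (subsets n) (ind (atop? n v p)) _)
                    (cong (ind (atop? n v p) *_) (sym (L-∑ (step-linear b n i) (subsets n) (fullChains P p) F))))) ⟩
      ∑ (allFin size) (λ p → ind (atop? n v p) * stepᵇ n (flagToric p n) i) ∎

  -- The two recurrences differ only in their top terms. For p of rank n + 1 the induction
  -- hypothesis at p turns `flagToric p n` into f of [0̂,p), and `stepᵇ` turns that into g.
  -- Quantifying over all v of rank above n makes the hypothesis available at v and at every such p.
  flagToric-partialToric : ∀ n v → n ℕ.< ρ v → flagToric v n ≗ partialToric v n
  flagToric-partialToric zero v 0<ρv i = begin
    fullChains P v Vec.[] * coeff 1ₚ i + 0ℚ   ≡⟨ cong (λ x → x * coeff 1ₚ i + 0ℚ) (fullChains-[] P v) ⟩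
    1ℚ * coeff 1ₚ i + 0ℚ                      ≡⟨ trans (ℚ.+-identityʳ _) (ℚ.*-identityˡ (coeff 1ₚ i)) ⟩
    coeff 1ₚ i                                ≡⟨ sym (partialToric-zero 0<ρv i) ⟩
    partialToric v 0 i                        ∎
    where open ≡-Reasoning
  flagToric-partialToric (suc n) v 1+n<ρv i = begin
    flagToric v (suc n) i
      ≡⟨ flagToric-suc v n i ⟩
    δ (flagToric v n) i + ∑ (allFin size) (λ p → ind (atop? n v p) * stepᵇ n (flagToric p n) i)
      ≡⟨ cong₂ _+_ (L-cong (δ-linear i) (flagToric-partialToric n v (ℕ.<⇒≤ 1+n<ρv)))
                   (∑-cong (allFin size) (λ p → top p (atop? n v p))) ⟩
    δ (partialToric v n) i + ∑ (allFin size) (λ p → ind (atop? n v p) * coeff (toricG P p) i)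
      ≡⟨ sym (partialToric-suc v n i) ⟩
    partialToric v (suc n) i ∎
    where
    open ≡-Reasoning
    top : ∀ p (atop : Dec (p < v × ρ p ≡ suc n)) →
          ind atop * stepᵇ n (flagToric p n) i ≡ ind atop * coeff (toricG P p) i
    top p (no _) = trans (ℚ.*-zeroˡ (stepᵇ n (flagToric p n) i)) (sym (ℚ.*-zeroˡ (coeff (toricG P p) i)))
    top p (yes (_ , ρp≡1+n)) = cong (1ℚ *_) (trans
      (L-cong (step-linear b n i) (λ j → trans
        (flagToric-partialToric n p (ℕ.≤-reflexive (sym ρp≡1+n)) j)
        (sym (toricF-partialToric ρp≡1+n j))))
      (sym (toricG-suc ρp≡1+n i)))

  toricF-flagToric : ∀ {v n} → ρ v ≡ suc n → coeff (toricF P v) ≗ flagToric v n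
  toricF-flagToric {v} {n} ρv≡1+n i = trans (toricF-partialToric ρv≡1+n i)
    (sym (flagToric-partialToric n v (ℕ.≤-reflexive (sym ρv≡1+n)) i))

theorem4p7 : (P : GradedPoset) → IsEulerian P →
    (n : ℕ) → GradedPoset.rank P ≡ suc n →
    (Φ : NCPoly CD) → IsCDIndex P n Φ →
    shortToric P n ≈ₚ (Φ ʳᵉᵛ⟨𝒞,𝒟⟩) 1ₚ
theorem4p7 P _ n rank≡1+n Φ isCD k = begin
  coeff (shortToric P n) k
    -- `shortPoly` repeats the formula of `shortToric` for an arbitrary sequence.
    ≡⟨⟩
  short n k (coeff (toricF P 1̂))
    ≡⟨ L-cong (short-linear n k) (toricF-flagToric P rank≡1+n) ⟩
  short n k (flagToric P 1̂ n)
    ≡⟨ L-∑ (short-linear n k) (subsets n) (fullChains P 1̂) (λ T → flagSeq 0 T (coeff 1ₚ)) ⟩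
  ∑ (subsets n) (λ T → fullChains P 1̂ T * short n k (flagSeq 0 T (coeff 1ₚ)))
    ≡⟨ ∑-cong (subsets n) (λ T → cong (_* short n k (flagSeq 0 T (coeff 1ₚ)))
         (sym (flagF-fullChains P rank≡1+n T))) ⟩
  ∑ (subsets n) (λ T → ι (ℤ.+ flagF P T) * short n k (flagSeq 0 T (coeff 1ₚ)))
    ≡⟨ sym (eval-abIndex P n k (coeff 1ₚ)) ⟩
  eval (λ w → shortWord 0 k w (coeff 1ₚ)) (abIndex P n)
    -- The cd-index is known only through equal word coefficients, which determine every value of
    -- `eval`.
    ≡⟨ sym (eval-EqNC _≟ᴬᴮ_ (λ w → shortWord 0 k w (coeff 1ₚ)) (substitute cd→ab Φ) (abIndex P n) isCD) ⟩
  eval (λ w → shortWord 0 k w (coeff 1ₚ)) (substitute cd→ab Φ)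
    ≡⟨ eval-shortWord-substitute Φ k ⟩
  coeff ((Φ ʳᵉᵛ⟨𝒞,𝒟⟩) 1ₚ) k ∎
  where
  open ≡-Reasoning
  open GradedPoset P using (1̂)
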